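{- Let $M$ be a recursively enumerable language over a finite alphabet $\Sigma$ which does not contain the empty word. Then for each of the calculi $\mathcal{M}'^{ -,\mathrm{mult}}_{2018}$ and $\mathcal{F}^{ -,\mathrm{mult}}_{2018}$ there exists a grammar based on that calculus which generates $M$, both in the sense of s-recognition and in the sense of t-recognition.
   Context: Formulae are built from a countable set of variables by $\backslash,/,\cdot$ and the unary $\langle\rangle$, $[]^{ -1}$, $!$ (no $\mathbf1$, no $\wedge,\vee$). $\mathcal{M}'^{ -,\mathrm{mult}}_{2018}$ (with stoups): a stoup is a finite multiset of formulae ($\varnothing$ empty); a tree term is a formula or $[\Xi]$ with $\Xi$ a meta-formula; a meta-formula is $\zeta;\Gamma$ ($\zeta$ a stoup, $\Gamma$ a finite sequence of tree terms, empty $\Lambda$), $\varnothing;\Gamma$ written $\Gamma$; comma is concatenation / multiset union; sequents $\Xi\to C$; $\Xi(\Theta)$ designates an occurrence of a meta-formula $\Theta$ which is $\Xi$ itself or the content of a bracket $[\Theta]$ at any depth. Rules: axiom $A\to A$; ($/L$) from $\zeta_1;\Gamma\to B$ and $\Xi(\zeta_2;\Delta_1,C,\Delta_2)\to D$ infer $\Xi(\zeta_1,\zeta_2;\Delta_1,C/B,\Gamma,\Delta_2)\to D$; ($/R$) from $\zeta;\Gamma,B\to C$ infer $\zeta;\Gamma\to C/B$, only if $\Gamma\ne\Lambda$ or $\zeta\ne\varnothing$; ($\backslash L$) from $\zeta_1;\Gamma\to A$ and $\Xi(\zeta_2;\Delta_1,C,\Delta_2)\to D$ infer $\Xi(\zeta_1,\zeta_2;\Delta_1,\Gamma,A\backslash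 C,\Delta_2)\to D$; ($\backslash R$) from $\zeta;A,\Gamma\to C$ infer $\zeta;\Gamma\to A\backslash C$, only if $\Gamma\neq\Lambda$ or $\zeta\neq\varnothing$; ($\cdot L$) from $\Xi(\zeta;\Delta_1,A,B,\Delta_2)\to D$ infer $\Xi(\zeta;\Delta_1,A\cdot B,\Delta_2)\to D$; ($\cdot R$) from $\zeta_1;\Delta\to A$, $\zeta_2;\Gamma\to B$ infer $\zeta_1,\zeta_2;\Delta,\Gamma\to A\cdot B$; ($[]^{ -1}L$) from $\Xi(\zeta;\Delta_1,A,\Delta_2)\to B$ infer $\Xi(\zeta;\Delta_1,[[]^{ -1}A],\Delta_2)\to B$; ($[]^{ -1}R$) from $[\Xi]\to A$ infer $\Xi\to[]^{ -1}A$; ($\langle\rangle L$) from $\Xi(\zeta;\Delta_1,[A],\Delta_2)\to B$ infer $\Xi(\zeta;\Delta_1,\langle\rangle A,\Delta_2)\to B$; ($\langle\rangle R$) from $\Xi\to A$ infer $[\Xi]\to\langle\rangle A$; ($!L$) from $\Xi(\zeta,A;\Gamma_1,\Gamma_2)\to B$ infer $\Xi(\zeta;\Gamma_1,!A,\Gamma_2)\to B$; ($!P$) from $\Xi(\zeta;\Gamma_1,A,\Gamma_2)\to B$ infer $\Xi(\zeta,A;\Gamma_1,\Gamma_2)\to B$; ($!R'$) from $A;\Lambda\to B$ infer $A;\Lambda\to!B$; ($!C'$) from $\Xi(\zeta,A;\Gamma_1,[\zeta',A;\Gamma_2],\Gamma_3)\to B$ infer $\Xi(\zeta,A;\Gamma_1,[[\zeta';\Gamma_2]],\Gamma_3)\to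 B$, only if $\Gamma_2\ne\Lambda$ or $\zeta'\ne\varnothing$. Cut is not a rule. $\mathcal{F}^{ -,\mathrm{mult}}_{2018}$ (stoup-free): meta-formulae are finite sequences of tree terms; rules: axiom $A\to A$; the stoup-free versions of $/L$, $/R$ (only if $\Gamma\ne\Lambda$), $\backslash L$, $\backslash R$ (only if $\Gamma\ne\Lambda$), $\cdot L$, $\cdot R$, $[]^{ -1}L$, $[]^{ -1}R$, $\langle\rangle L$, $\langle\rangle R$ (drop all stoups); ($!L$) from $\Xi(\Delta_1,A,\Delta_2)\to C$ infer $\Xi(\Delta_1,!A,\Delta_2)\to C$; ($!P_1$) from $\Xi(\Delta_1,!A,\Phi,\Delta_2)\to C$ infer $\Xi(\Delta_1,\Phi,!A,\Delta_2)\to C$; ($!P_2$) the converse; ($!R$) from $!A\to B$ infer $!A\to!B$; ($!C$) from $\Xi(!A,\Gamma_1,[!A,\Gamma_2],\Gamma_3)\to C$ infer $\Xi(!A,\Gamma_1,[[\Gamma_2]],\Gamma_3)\to C$, only if $\Gamma_2\neq\Lambda$; (cut) from $\Pi\to A$ and $\Xi(\Gamma_1,A,\Gamma_2)\to C$ infer $\Xi(\Gamma_1,\Pi,\Gamma_2)\to C$. Grammars: a grammar is a triple $\langle\Sigma,\rhd,H\rangle$ with $H$ a formula and $\rhd$ a finite relation between letters of $\Sigma$ and formulae. s-recognition accepts $a_1\dots a_n$ if $A_1,\dots,A_n\to H$ (no brackets, empty stoups) is derivable for some $A_i$ with $a_i\rhd A_i$; t-recognition accepts $a_1\dots a_n$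 if $\Pi\to H$ is derivable for some meta-formula $\Pi$ with empty stoups which becomes $A_1,\dots,A_n$ after removing all brackets (not bracket modalities), for some $a_i\rhd A_i$. The grammar generates $M$ in a given sense if the set of words accepted in that sense equals $M$. -}

module Defs where

open import Data.Nat using (ℕ)
open import Data.Fin using (Fin)
open import Data.List using (List; []; _∷_; _++_; map)
open import Data.List.Membership.Propositional using () renaming (_∈_ to _∈ˡ_)
open import Data.List.Relation.Binary.Permutation.Propositional using (_↭_)
open import Data.List.Relation.Binary.Pointwise using (Pointwise)
open import Data.List.Relation.Unary.All using (All)
open import Data.Maybe using (Maybe; just)
open import Data.Product using (∃-syntax; _×_; _,_)
open import Data.Sum using (_⊎_)
open import Relation.Binary.Construct.Closure.ReflexiveTransitive using (Star)
open import Relation.Binary.PropositionalEquality using (_≡_; _≢_)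
open import Relation.Unary using (Pred; _≐_)

-- The alphabet is Fin k, and a language over it is a predicate on words.

Word : ℕ → Set
Word k = List (Fin k)

------------------------------------------------------------------------
-- Recursively enumerable languages: those accepted by a deterministic
-- Turing machine with one two-way infinite tape.

data Symbol (k m : ℕ) : Set where
  blank : Symbol k m
  input : Fin k → Symbol k m
  work  : Fin m → Symbol k m

data Direction : Set where
  left right : Direction

record TuringMachine (k : ℕ) : Set where
  field
    #states : ℕ
    #work   : ℕ
    start   : Fin #states
    accept  : Fin #states
    -- the machine halts where δ is undefined
    δ       : Fin #states → Symbol k #work →
              Maybe (Fin #states × Symbol k #work × Direction)

module _ {k : ℕ} (T : TuringMachine k) where
  open TuringMachine T

  private
    Cell : Set
    Cell = Symbol k #work

  -- Both half-tapes are listed starting from the cell next to the head;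
  -- all cells beyond the ends of the two lists are blank.
  record Configuration : Set where
    constructor config
    field
      leftTape  : List Cell
      state     : Fin #states
      scanned   : Cell
      rightTape : List Cell

  open Configuration

  move : Direction → List Cell → Fin #states → Cell → List Cell → Configuration
  move left  []       q s rs       = config [] q blank (s ∷ rs)
  move left  (l ∷ ls) q s rs       = config ls q l (s ∷ rs)
  move right ls       q s []       = config (s ∷ ls) q blank []
  move right ls       q s (r ∷ rs) = config (s ∷ ls) q r rs

  data _⟶_ : Configuration → Configuration → Set where
    step : ∀ {ls q s rs q′ s′ d} → δ q s ≡ just (q′ , s′ , d) →
           config ls q s rs ⟶ move d ls q′ s′ rs

  initial : Word k → Configuration
  initial []      = config [] start blank []
  initial (a ∷ w) = config [] start (input a) (map input w)

  Accepts : Pred (Word k) _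
  Accepts w = ∃[ c ] Star _⟶_ (initial w) c × state c ≡ accept

RecursivelyEnumerable : ∀ {ℓ} {k : ℕ} → Pred (Word k) ℓ → Set ℓ
RecursivelyEnumerable {k = k} M = ∃[ T ] M ≐ Accepts {k} T

infixr 7 _\\_
infixl 7 _//_
infixl 8 _·_
infix  9 ⟨⟩_ []⁻¹_ !_

data Formula : Set where
  var   : ℕ → Formula
  _\\_  : Formula → Formula → Formula
  _//_  : Formula → Formula → Formula
  _·_   : Formula → Formula → Formula
  ⟨⟩_   : Formula → Formula
  []⁻¹_ : Formula → Formula
  !_    : Formula → Formula

record Grammar (k : ℕ) : Set where
  field
    lexicon : List (Fin k × Formula)
    goal    : Formula

  _▷_ : Fin k → Formula → Set
  a ▷ A = (a , A) ∈ˡ lexicon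

------------------------------------------------------------------------
-- 𝓜′⁻ᵐᵘˡᵗ₂₀₁₈

module StoupCalculus where

  infix 4 _⨾_

  -- A stoup is a finite multiset, represented by a list; see _≈_ below.
  Stoup : Set
  Stoup = List Formula

  mutual
    data TreeTerm : Set where
      fm  : Formula → TreeTerm
      [_] : Meta → TreeTerm

    data Meta : Set where
      _⨾_ : Stoup → List TreeTerm → Meta

  -- Equality of meta-formulae when their stoups, at every depth, are read
  -- as multisets.
  mutual
    data _≈ₜ_ : TreeTerm → TreeTerm → Set where
      fm  : ∀ {A} → fm A ≈ₜ fm A
      [_] : ∀ {Ξ Ξ′} → Ξ ≈ Ξ′ → [ Ξ ] ≈ₜ [ Ξ′ ]

    data _≈_ : Meta → Meta → Set where
      _⨾_ : ∀ {ζ ζ′ Γ Γ′} → ζ ↭ ζ′ → Pointwise _≈ₜ_ Γ Γ′ →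
            (ζ ⨾ Γ) ≈ (ζ′ ⨾ Γ′)

  -- Meta-formulae with a designated occurrence of a meta-formula, namely
  -- the whole or the content of a bracket.
  data Context : Set where
    ∙      : Context
    within : Stoup → List TreeTerm → Context → List TreeTerm → Context

  _⟪_⟫ : Context → Meta → Meta
  ∙                 ⟪ Θ ⟫ = Θ
  within ζ Γ₁ Ξ Γ₂  ⟪ Θ ⟫ = ζ ⨾ Γ₁ ++ [ Ξ ⟪ Θ ⟫ ] ∷ Γ₂

  infix 3 _⊢_

  data _⊢_ : Meta → Formula → Set where

    -- Not a rule of the calculus: it identifies the representatives of one
    -- and the same sequent.
    conv : ∀ {Ξ Ξ′ C} → Ξ ≈ Ξ′ → Ξ ⊢ C → Ξ′ ⊢ C

    ax : ∀ {A} → [] ⨾ fm A ∷ [] ⊢ A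

    //L : ∀ Ξ {ζ₁ ζ₂ Γ Δ₁ Δ₂ B C D} →
          ζ₁ ⨾ Γ ⊢ B →
          Ξ ⟪ ζ₂ ⨾ Δ₁ ++ fm C ∷ Δ₂ ⟫ ⊢ D →
          Ξ ⟪ ζ₁ ++ ζ₂ ⨾ Δ₁ ++ fm (C // B) ∷ Γ ++ Δ₂ ⟫ ⊢ D

    //R : ∀ {ζ Γ B C} → Γ ≢ [] ⊎ ζ ≢ [] →
          ζ ⨾ Γ ++ fm B ∷ [] ⊢ C →
          ζ ⨾ Γ ⊢ C // B

    \\L : ∀ Ξ {ζ₁ ζ₂ Γ Δ₁ Δ₂ A C D} →
          ζ₁ ⨾ Γ ⊢ A →
          Ξ ⟪ ζ₂ ⨾ Δ₁ ++ fm C ∷ Δ₂ ⟫ ⊢ D →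
          Ξ ⟪ ζ₁ ++ ζ₂ ⨾ Δ₁ ++ Γ ++ fm (A \\ C) ∷ Δ₂ ⟫ ⊢ D

    \\R : ∀ {ζ Γ A C} → Γ ≢ [] ⊎ ζ ≢ [] →
          ζ ⨾ fm A ∷ Γ ⊢ C →
          ζ ⨾ Γ ⊢ A \\ C

    ·L : ∀ Ξ {ζ Δ₁ Δ₂ A B D} →
         Ξ ⟪ ζ ⨾ Δ₁ ++ fm A ∷ fm B ∷ Δ₂ ⟫ ⊢ D →
         Ξ ⟪ ζ ⨾ Δ₁ ++ fm (A · B) ∷ Δ₂ ⟫ ⊢ D

    ·R : ∀ {ζ₁ ζ₂ Δ Γ A B} →
         ζ₁ ⨾ Δ ⊢ A →
         ζ₂ ⨾ Γ ⊢ B →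
         ζ₁ ++ ζ₂ ⨾ Δ ++ Γ ⊢ A · B

    []⁻¹L : ∀ Ξ {ζ Δ₁ Δ₂ A B} →
            Ξ ⟪ ζ ⨾ Δ₁ ++ fm A ∷ Δ₂ ⟫ ⊢ B →
            Ξ ⟪ ζ ⨾ Δ₁ ++ [ [] ⨾ fm ([]⁻¹ A) ∷ [] ] ∷ Δ₂ ⟫ ⊢ B

    []⁻¹R : ∀ {Ξ A} →
            [] ⨾ [ Ξ ] ∷ [] ⊢ A →
            Ξ ⊢ []⁻¹ A

    ⟨⟩L : ∀ Ξ {ζ Δ₁ Δ₂ A B} →
          Ξ ⟪ ζ ⨾ Δ₁ ++ [ [] ⨾ fm A ∷ [] ] ∷ Δ₂ ⟫ ⊢ B →
          Ξ ⟪ ζ ⨾ Δ₁ ++ fm (⟨⟩ A) ∷ Δ₂ ⟫ ⊢ B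

    ⟨⟩R : ∀ {Ξ A} →
          Ξ ⊢ A →
          [] ⨾ [ Ξ ] ∷ [] ⊢ ⟨⟩ A

    !L : ∀ Ξ {ζ Γ₁ Γ₂ A B} →
         Ξ ⟪ A ∷ ζ ⨾ Γ₁ ++ Γ₂ ⟫ ⊢ B →
         Ξ ⟪ ζ ⨾ Γ₁ ++ fm (! A) ∷ Γ₂ ⟫ ⊢ B

    !P : ∀ Ξ {ζ Γ₁ Γ₂ A B} →
         Ξ ⟪ ζ ⨾ Γ₁ ++ fm A ∷ Γ₂ ⟫ ⊢ B →
         Ξ ⟪ A ∷ ζ ⨾ Γ₁ ++ Γ₂ ⟫ ⊢ B

    !R′ : ∀ {A B} →
          A ∷ [] ⨾ [] ⊢ B →
          A ∷ [] ⨾ [] ⊢ ! B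

    !C′ : ∀ Ξ {ζ ζ′ Γ₁ Γ₂ Γ₃ A B} → Γ₂ ≢ [] ⊎ ζ′ ≢ [] →
          Ξ ⟪ A ∷ ζ ⨾ Γ₁ ++ [ A ∷ ζ′ ⨾ Γ₂ ] ∷ Γ₃ ⟫ ⊢ B →
          Ξ ⟪ A ∷ ζ ⨾ Γ₁ ++ [ [] ⨾ [ ζ′ ⨾ Γ₂ ] ∷ [] ] ∷ Γ₃ ⟫ ⊢ B

  mutual
    data StouplessTerm : TreeTerm → Set where
      fm  : ∀ A → StouplessTerm (fm A)
      [_] : ∀ {Ξ} → Stoupless Ξ → StouplessTerm [ Ξ ]

    data Stoupless : Meta → Set where
      []⨾_ : ∀ {Γ} → All StouplessTerm Γ → Stoupless ([] ⨾ Γ)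

  -- Stoups are discarded, so this is meaningful only for stoupless
  -- meta-formulae.
  mutual
    debracket : Meta → List Formula
    debracket (_ ⨾ Γ) = debracketAll Γ

    debracketAll : List TreeTerm → List Formula
    debracketAll []          = []
    debracketAll (fm A  ∷ Γ) = A ∷ debracketAll Γ
    debracketAll ([ Ξ ] ∷ Γ) = debracket Ξ ++ debracketAll Γ

  module _ {k : ℕ} (G : Grammar k) where
    open Grammar G

    SRecognised : Pred (Word k) _
    SRecognised w = ∃[ As ] Pointwise _▷_ w As × ([] ⨾ map fm As ⊢ goal)

    TRecognised : Pred (Word k) _
    TRecognised w = ∃[ Π ] Stoupless Π × Pointwise _▷_ w (debracket Π) × (Π ⊢ goal)

------------------------------------------------------------------------
-- 𝓕⁻ᵐᵘˡᵗ₂₀₁₈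

module StoupFreeCalculus where

  mutual
    data TreeTerm : Set where
      fm  : Formula → TreeTerm
      [_] : Meta → TreeTerm

    Meta : Set
    Meta = List TreeTerm

  data Context : Set where
    ∙      : Context
    within : Meta → Context → Meta → Context

  _⟪_⟫ : Context → Meta → Meta
  ∙               ⟪ Θ ⟫ = Θ
  within Γ₁ Ξ Γ₂  ⟪ Θ ⟫ = Γ₁ ++ [ Ξ ⟪ Θ ⟫ ] ∷ Γ₂

  infix 3 _⊢_

  data _⊢_ : Meta → Formula → Set where

    ax : ∀ {A} → fm A ∷ [] ⊢ A

    //L : ∀ Ξ {Γ Δ₁ Δ₂ B C D} →
          Γ ⊢ B →
          Ξ ⟪ Δ₁ ++ fm C ∷ Δ₂ ⟫ ⊢ D →
          Ξ ⟪ Δ₁ ++ fm (C // B) ∷ Γ ++ Δ₂ ⟫ ⊢ D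

    //R : ∀ {Γ B C} → Γ ≢ [] →
          Γ ++ fm B ∷ [] ⊢ C →
          Γ ⊢ C // B

    \\L : ∀ Ξ {Γ Δ₁ Δ₂ A C D} →
          Γ ⊢ A →
          Ξ ⟪ Δ₁ ++ fm C ∷ Δ₂ ⟫ ⊢ D →
          Ξ ⟪ Δ₁ ++ Γ ++ fm (A \\ C) ∷ Δ₂ ⟫ ⊢ D

    \\R : ∀ {Γ A C} → Γ ≢ [] →
          fm A ∷ Γ ⊢ C →
          Γ ⊢ A \\ C

    ·L : ∀ Ξ {Δ₁ Δ₂ A B D} →
         Ξ ⟪ Δ₁ ++ fm A ∷ fm B ∷ Δ₂ ⟫ ⊢ D →
         Ξ ⟪ Δ₁ ++ fm (A · B) ∷ Δ₂ ⟫ ⊢ D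

    ·R : ∀ {Δ Γ A B} →
         Δ ⊢ A →
         Γ ⊢ B →
         Δ ++ Γ ⊢ A · B

    []⁻¹L : ∀ Ξ {Δ₁ Δ₂ A B} →
            Ξ ⟪ Δ₁ ++ fm A ∷ Δ₂ ⟫ ⊢ B →
            Ξ ⟪ Δ₁ ++ [ fm ([]⁻¹ A) ∷ [] ] ∷ Δ₂ ⟫ ⊢ B

    []⁻¹R : ∀ {Ξ A} →
            [ Ξ ] ∷ [] ⊢ A →
            Ξ ⊢ []⁻¹ A

    ⟨⟩L : ∀ Ξ {Δ₁ Δ₂ A B} →
          Ξ ⟪ Δ₁ ++ [ fm A ∷ [] ] ∷ Δ₂ ⟫ ⊢ B →
          Ξ ⟪ Δ₁ ++ fm (⟨⟩ A) ∷ Δ₂ ⟫ ⊢ B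

    ⟨⟩R : ∀ {Ξ A} →
          Ξ ⊢ A →
          [ Ξ ] ∷ [] ⊢ ⟨⟩ A

    !L : ∀ Ξ {Δ₁ Δ₂ A C} →
         Ξ ⟪ Δ₁ ++ fm A ∷ Δ₂ ⟫ ⊢ C →
         Ξ ⟪ Δ₁ ++ fm (! A) ∷ Δ₂ ⟫ ⊢ C

    !P₁ : ∀ Ξ {Δ₁ Φ Δ₂ A C} →
          Ξ ⟪ Δ₁ ++ fm (! A) ∷ Φ ++ Δ₂ ⟫ ⊢ C →
          Ξ ⟪ Δ₁ ++ Φ ++ fm (! A) ∷ Δ₂ ⟫ ⊢ C

    !P₂ : ∀ Ξ {Δ₁ Φ Δ₂ A C} →
          Ξ ⟪ Δ₁ ++ Φ ++ fm (! A) ∷ Δ₂ ⟫ ⊢ C →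
          Ξ ⟪ Δ₁ ++ fm (! A) ∷ Φ ++ Δ₂ ⟫ ⊢ C

    !R : ∀ {A B} →
         fm (! A) ∷ [] ⊢ B →
         fm (! A) ∷ [] ⊢ ! B

    !C : ∀ Ξ {Γ₁ Γ₂ Γ₃ A C} → Γ₂ ≢ [] →
         Ξ ⟪ fm (! A) ∷ Γ₁ ++ [ fm (! A) ∷ Γ₂ ] ∷ Γ₃ ⟫ ⊢ C →
         Ξ ⟪ fm (! A) ∷ Γ₁ ++ [ [ Γ₂ ] ∷ [] ] ∷ Γ₃ ⟫ ⊢ C

    cut : ∀ Ξ {Π Γ₁ Γ₂ A C} →
          Π ⊢ A →
          Ξ ⟪ Γ₁ ++ fm A ∷ Γ₂ ⟫ ⊢ C →
          Ξ ⟪ Γ₁ ++ Π ++ Γ₂ ⟫ ⊢ C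

  debracket : Meta → List Formula
  debracket []          = []
  debracket (fm A  ∷ Γ) = A ∷ debracket Γ
  debracket ([ Ξ ] ∷ Γ) = debracket Ξ ++ debracket Γ

  module _ {k : ℕ} (G : Grammar k) where
    open Grammar G

    SRecognised : Pred (Word k) _
    SRecognised w = ∃[ As ] Pointwise _▷_ w As × (map fm As ⊢ goal)

    TRecognised : Pred (Word k) _
    TRecognised w = ∃[ Π ] Pointwise _▷_ w (debracket Π) × (Π ⊢ goal)

{-# OPTIONS --safe #-}

-- A Turing machine is turned into a semi-Thue system, whose letters x become
-- the formulae ⟨⟩ ⟨⟩ var x.  A rule a b… → c… becomes
-- G = var a \\ []⁻¹ (⨂ c… // ⨂ b…).  When a occurs in an antecedent with G in
-- the stoup, it unfolds to a double bracket; contraction turns that into a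
-- single bracket holding a copy of G, which there rewrites var a to []⁻¹ of a
-- formula that the last bracket then releases next to b….  The goal formula
-- loads all the G into the stoup, and takes the unused ones back at the end.
--
-- One grammar serves both calculi and both senses of recognition:
-- 𝓜′ embeds into 𝓕 by reading a stoup as a sequence of !-formulae, so it is
-- enough to derive accepted words in 𝓜′ and to refute the others in 𝓕.  For the
-- latter, cut included, formulae are interpreted as up-sets of the ordered
-- monoid of monotone predicate transformers, with brackets erased, and the
-- letters act on sets of half-tapes so that a rewriting step can only
-- decrease the value of a word.

module Submission where

open import Defs
open import Data.Fin using (Fin; toℕ)
open import Data.Fin.Properties using (toℕ-injective)
open import Data.List using (List; []; _∷_; _++_; _ʳ++_; map; allFin; cartesianProduct)
open import Data.List.Membership.Propositional using (_∈_)
open import Data.List.Membership.Propositional.Properties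
  using (∈-map⁺; ∈-map⁻; ∈-++⁺ˡ; ∈-++⁺ʳ; ∈-∃++; ∈-allFin; ∈-cartesianProduct⁺)
open import Data.List.Membership.Setoid.Properties using (index-injective)
open import Data.List.Properties using (++-assoc; ++-identityʳ; ++-monoid; map-++)
open import Data.List.Relation.Binary.Permutation.Propositional using (_↭_; refl; prep; swap; trans; ↭-sym)
open import Data.List.Relation.Binary.Permutation.Propositional.Properties using (shift)
open import Data.List.Relation.Binary.Pointwise using (Pointwise; []; _∷_)
open import Data.List.Relation.Unary.All using (All; []; _∷_)
open import Data.List.Relation.Unary.Any using (here; there; index)
open import Data.Maybe using (Maybe; just; nothing)
open import Data.Nat using (ℕ)
open import Data.Product using (∃-syntax; _×_; _,_)
open import Data.Sum using (_⊎_; inj₁; inj₂)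
open import Data.Unit using (⊤; tt)
open import Function using (_∘_; id)
open import Level using (0ℓ; suc)
open import Relation.Binary.Construct.Closure.ReflexiveTransitive using (Star; ε; _◅_; _◅◅_)
open import Relation.Binary.PropositionalEquality as ≡ using (_≡_; _≢_; refl; cong; cong₂; sym; subst)
open import Relation.Unary using (Pred; _≐_; _∉_; _⊆_)
open import Tactic.MonoidSolver using (solve)

module S = StoupCalculus
module F = StoupFreeCalculus

-- Embedding the calculus with stoups into the one without

module StoupFreeRewriting where
  open F

  -- The antecedent-transforming rules, closed under arbitrary surroundings.
  record _⟹_ (Θ Θ′ : Meta) : Set where
    constructor rule
    field
      at : ∀ Ξ Δ₁ Δ₂ {C} → Ξ ⟪ Δ₁ ++ Θ ++ Δ₂ ⟫ ⊢ C → Ξ ⟪ Δ₁ ++ Θ′ ++ Δ₂ ⟫ ⊢ C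

  open _⟹_ public

  infix  2 _⟹_
  infixr 1 _»_

  _»_ : ∀ {Θ Θ′ Θ″} → Θ ⟹ Θ′ → Θ′ ⟹ Θ″ → Θ ⟹ Θ″
  at (r » s) Ξ Δ₁ Δ₂ = at s Ξ Δ₁ Δ₂ ∘ at r Ξ Δ₁ Δ₂

  ≡⇒⟹ : ∀ {Θ Θ′} → Θ ≡ Θ′ → Θ ⟹ Θ′
  ≡⇒⟹ refl = rule λ _ _ _ d → d

  ⟹-refl : ∀ {Θ} → Θ ⟹ Θ
  ⟹-refl = ≡⇒⟹ refl

  ++⁺ˡ : ∀ Φ {Θ Θ′} → Θ ⟹ Θ′ → Φ ++ Θ ⟹ Φ ++ Θ′
  at (++⁺ˡ Φ {Θ} {Θ′} r) Ξ Δ₁ Δ₂ d =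
    subst (λ Γ → Ξ ⟪ Γ ⟫ ⊢ _) (sym (assoc Θ′))
      (at r Ξ (Δ₁ ++ Φ) Δ₂ (subst (λ Γ → Ξ ⟪ Γ ⟫ ⊢ _) (assoc Θ) d))
    where
    assoc : ∀ Θ → Δ₁ ++ (Φ ++ Θ) ++ Δ₂ ≡ (Δ₁ ++ Φ) ++ Θ ++ Δ₂
    assoc Θ = solve (++-monoid TreeTerm)

  ++⁺ʳ : ∀ Φ {Θ Θ′} → Θ ⟹ Θ′ → Θ ++ Φ ⟹ Θ′ ++ Φ
  at (++⁺ʳ Φ {Θ} {Θ′} r) Ξ Δ₁ Δ₂ d =
    subst (λ Γ → Ξ ⟪ Δ₁ ++ Γ ⟫ ⊢ _) (sym (++-assoc Θ′ Φ Δ₂))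
      (at r Ξ Δ₁ (Φ ++ Δ₂) (subst (λ Γ → Ξ ⟪ Δ₁ ++ Γ ⟫ ⊢ _) (++-assoc Θ Φ Δ₂) d))

  ++⁺ : ∀ {Θ Θ′ Φ Φ′} → Θ ⟹ Θ′ → Φ ⟹ Φ′ → Θ ++ Φ ⟹ Θ′ ++ Φ′
  ++⁺ {Θ′ = Θ′} {Φ = Φ} r s = ++⁺ʳ Φ r » ++⁺ˡ Θ′ s

  _⊚_ : Context → Context → Context
  ∙                ⊚ Ψ = Ψ
  within Γ₁ Ξ Γ₂   ⊚ Ψ = within Γ₁ (Ξ ⊚ Ψ) Γ₂

  ⊚-⟪⟫ : ∀ Ξ Ψ Θ → (Ξ ⊚ Ψ) ⟪ Θ ⟫ ≡ Ξ ⟪ Ψ ⟪ Θ ⟫ ⟫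
  ⊚-⟪⟫ ∙                Ψ Θ = refl
  ⊚-⟪⟫ (within Γ₁ Ξ Γ₂) Ψ Θ = cong (λ Θ′ → Γ₁ ++ [ Θ′ ] ∷ Γ₂) (⊚-⟪⟫ Ξ Ψ Θ)

  -- The bracket is absorbed into the surroundings: rewriting its content amounts to rewriting at
  -- the hole of a deeper context.
  bracket⁺ : ∀ {Θ Θ′} → Θ ⟹ Θ′ → [ Θ ] ∷ [] ⟹ [ Θ′ ] ∷ []
  at (bracket⁺ {Θ} {Θ′} r) Ξ Δ₁ Δ₂ d =
    subst (_⊢ _) (zoom Θ′)
      (at r (Ξ ⊚ within Δ₁ ∙ Δ₂) [] [] (subst (_⊢ _) (sym (zoom Θ)) d))
    where
    zoom : ∀ Θ → (Ξ ⊚ within Δ₁ ∙ Δ₂) ⟪ Θ ++ [] ⟫ ≡ Ξ ⟪ Δ₁ ++ [ Θ ] ∷ Δ₂ ⟫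
    zoom Θ = ≡.trans (⊚-⟪⟫ Ξ _ _) (cong (λ Γ → Ξ ⟪ Δ₁ ++ [ Γ ] ∷ Δ₂ ⟫) (++-identityʳ Θ))

  apply : ∀ {Θ Θ′ C} → Θ ⟹ Θ′ → Θ ⊢ C → Θ′ ⊢ C
  apply {Θ} {Θ′} r d =
    subst (_⊢ _) (++-identityʳ Θ′) (at r ∙ [] [] (subst (_⊢ _) (sym (++-identityʳ Θ)) d))

  bangs : List Formula → Meta
  bangs = map (fm ∘ !_)

  bang-float₁ : ∀ A Φ → Φ ++ fm (! A) ∷ [] ⟹ fm (! A) ∷ Φ
  at (bang-float₁ A Φ) Ξ Δ₁ Δ₂ d =
    !P₂ Ξ {Δ₁} {Φ} (subst (λ Γ → Ξ ⟪ Δ₁ ++ Γ ⟫ ⊢ _) (++-assoc Φ _ Δ₂) d)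

  bang-sink₁ : ∀ A Φ → fm (! A) ∷ Φ ⟹ Φ ++ fm (! A) ∷ []
  at (bang-sink₁ A Φ) Ξ Δ₁ Δ₂ d =
    subst (λ Γ → Ξ ⟪ Δ₁ ++ Γ ⟫ ⊢ _) (sym (++-assoc Φ _ Δ₂)) (!P₁ Ξ {Δ₁} {Φ} d)

  bangs-float : ∀ ζ Φ Ψ → Φ ++ bangs ζ ++ Ψ ⟹ bangs ζ ++ Φ ++ Ψ
  bangs-float []      Φ Ψ = ⟹-refl
  bangs-float (A ∷ ζ) Φ Ψ =
    ≡⇒⟹ (sym (++-assoc Φ (fm (! A) ∷ []) (bangs ζ ++ Ψ)))
    » ++⁺ʳ (bangs ζ ++ Ψ) (bang-float₁ A Φ)
    » ++⁺ˡ (fm (! A) ∷ []) (bangs-float ζ Φ Ψ)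

  bangs-sink : ∀ ζ Φ Ψ → bangs ζ ++ Φ ++ Ψ ⟹ Φ ++ bangs ζ ++ Ψ
  bangs-sink []      Φ Ψ = ⟹-refl
  bangs-sink (A ∷ ζ) Φ Ψ =
    ++⁺ˡ (fm (! A) ∷ []) (bangs-sink ζ Φ Ψ)
    » ++⁺ʳ (bangs ζ ++ Ψ) (bang-sink₁ A Φ)
    » ≡⇒⟹ (++-assoc Φ (fm (! A) ∷ []) (bangs ζ ++ Ψ))

  bangs-↭ : ∀ {ζ ζ′} → ζ ↭ ζ′ → bangs ζ ⟹ bangs ζ′
  bangs-↭ refl         = ⟹-refl
  bangs-↭ (prep A p)   = ++⁺ˡ (fm (! A) ∷ []) (bangs-↭ p)
  bangs-↭ (swap {xs = ζ} A B p) =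
    ++⁺ʳ (bangs ζ) (bang-sink₁ A (fm (! B) ∷ [])) » ++⁺ˡ (fm (! B) ∷ fm (! A) ∷ []) (bangs-↭ p)
  bangs-↭ (trans p q)  = bangs-↭ p » bangs-↭ q

  //⟹ : ∀ {Γ B C} → Γ ⊢ B → fm C ∷ [] ⟹ fm (C // B) ∷ Γ
  at (//⟹ d) Ξ Δ₁ Δ₂ = //L Ξ {Δ₁ = Δ₁} d

  \\⟹ : ∀ {Γ A C} → Γ ⊢ A → fm C ∷ [] ⟹ Γ ++ fm (A \\ C) ∷ []
  at (\\⟹ {Γ} d) Ξ Δ₁ Δ₂ e =
    subst (λ Γ → Ξ ⟪ Δ₁ ++ Γ ⟫ ⊢ _) (sym (++-assoc Γ _ Δ₂)) (\\L Ξ {Δ₁ = Δ₁} d e)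

  ·⟹ : ∀ {A B} → fm A ∷ fm B ∷ [] ⟹ fm (A · B) ∷ []
  at ·⟹ Ξ Δ₁ Δ₂ = ·L Ξ {Δ₁}

  []⁻¹⟹ : ∀ {A} → fm A ∷ [] ⟹ [ fm ([]⁻¹ A) ∷ [] ] ∷ []
  at []⁻¹⟹ Ξ Δ₁ Δ₂ = []⁻¹L Ξ {Δ₁}

  ⟨⟩⟹ : ∀ {A} → [ fm A ∷ [] ] ∷ [] ⟹ fm (⟨⟩ A) ∷ []
  at ⟨⟩⟹ Ξ Δ₁ Δ₂ = ⟨⟩L Ξ {Δ₁}

  !⟹ : ∀ {A} → fm A ∷ [] ⟹ fm (! A) ∷ []
  at !⟹ Ξ Δ₁ Δ₂ = !L Ξ {Δ₁}

  contract : ∀ A Γ₁ {Γ₂} Γ₃ → Γ₂ ≢ [] →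
             fm (! A) ∷ Γ₁ ++ [ fm (! A) ∷ Γ₂ ] ∷ Γ₃ ⟹ fm (! A) ∷ Γ₁ ++ [ [ Γ₂ ] ∷ [] ] ∷ Γ₃
  at (contract A Γ₁ {Γ₂} Γ₃ Γ₂≢[]) Ξ Δ₁ Δ₂ d =
    -- `!C` wants `! A` leftmost in its meta-formula, so `! A` is moved in front of `Δ₁`, contracted
    -- there and moved back.
    !P₁ Ξ {[]} {Δ₁} (subst (λ Γ → Ξ ⟪ fm (! A) ∷ Γ ⟫ ⊢ _) (sym (assoc _))
      (!C Ξ {Δ₁ ++ Γ₁} Γ₂≢[] (subst (λ Γ → Ξ ⟪ fm (! A) ∷ Γ ⟫ ⊢ _) (assoc _)
        (!P₂ Ξ {[]} {Δ₁} d))))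
    where
    assoc₁ : ∀ Ψ → Δ₁ ++ (Γ₁ ++ Ψ ++ Γ₃) ++ Δ₂ ≡ (Δ₁ ++ Γ₁) ++ Ψ ++ Γ₃ ++ Δ₂
    assoc₁ Ψ = solve (++-monoid TreeTerm)

    assoc : ∀ T → Δ₁ ++ (Γ₁ ++ T ∷ Γ₃) ++ Δ₂ ≡ (Δ₁ ++ Γ₁) ++ T ∷ Γ₃ ++ Δ₂
    assoc T = assoc₁ (T ∷ [])

module Embedding where
  open StoupFreeRewriting
  open S using (fm; [_]; _⨾_; ∙; within)

  mutual
    ⌊_⌋ₜ : S.TreeTerm → F.TreeTerm
    ⌊ fm A ⌋ₜ  = F.fm A
    ⌊ [ Ξ ] ⌋ₜ = F.[ ⌊ Ξ ⌋ ]

    ⌊_⌋* : List S.TreeTerm → F.Meta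
    ⌊ [] ⌋*    = []
    ⌊ T ∷ Γ ⌋* = ⌊ T ⌋ₜ ∷ ⌊ Γ ⌋*

    ⌊_⌋ : S.Meta → F.Meta
    ⌊ ζ ⨾ Γ ⌋ = bangs ζ ++ ⌊ Γ ⌋*

  ⌊⌋*-++ : ∀ Γ Δ → ⌊ Γ ++ Δ ⌋* ≡ ⌊ Γ ⌋* ++ ⌊ Δ ⌋*
  ⌊⌋*-++ []      Δ = refl
  ⌊⌋*-++ (T ∷ Γ) Δ = cong (⌊ T ⌋ₜ ∷_) (⌊⌋*-++ Γ Δ)

  ⌊⌋-nonempty : ∀ {ζ Γ} → Γ ≢ [] ⊎ ζ ≢ [] → ⌊ ζ ⨾ Γ ⌋ ≢ []
  ⌊⌋-nonempty {[]}    {[]}    (inj₁ Γ≢[]) _ = Γ≢[] refl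
  ⌊⌋-nonempty {[]}    {[]}    (inj₂ ζ≢[]) _ = ζ≢[] refl
  ⌊⌋-nonempty {[]}    {_ ∷ _} _ ()
  ⌊⌋-nonempty {_ ∷ _} {_}     _ ()

  focus : ∀ ζ Δ₁ Θ Δ₂ →
          ⌊ ζ ⨾ Δ₁ ++ Θ ++ Δ₂ ⌋ ≡ bangs ζ ++ ⌊ Δ₁ ⌋* ++ ⌊ Θ ⌋* ++ ⌊ Δ₂ ⌋*
  focus ζ Δ₁ Θ Δ₂ = cong (bangs ζ ++_)
    (≡.trans (⌊⌋*-++ Δ₁ (Θ ++ Δ₂)) (cong (⌊ Δ₁ ⌋* ++_) (⌊⌋*-++ Θ Δ₂)))

  ⌊⌋-local : ∀ ζ Δ₁ Θ Θ′ Δ₂ → ⌊ Θ ⌋* ⟹ ⌊ Θ′ ⌋* →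
             ⌊ ζ ⨾ Δ₁ ++ Θ ++ Δ₂ ⌋ ⟹ ⌊ ζ ⨾ Δ₁ ++ Θ′ ++ Δ₂ ⌋
  ⌊⌋-local ζ Δ₁ Θ Θ′ Δ₂ r =
    ≡⇒⟹ (focus ζ Δ₁ Θ Δ₂)
    » ++⁺ˡ (bangs ζ) (++⁺ˡ ⌊ Δ₁ ⌋* (++⁺ʳ ⌊ Δ₂ ⌋* r))
    » ≡⇒⟹ (sym (focus ζ Δ₁ Θ′ Δ₂))

  ⌊⌋-context : ∀ Ξ {Θ Θ′} → ⌊ Θ ⌋ ⟹ ⌊ Θ′ ⌋ → ⌊ Ξ S.⟪ Θ ⟫ ⌋ ⟹ ⌊ Ξ S.⟪ Θ′ ⟫ ⌋
  ⌊⌋-context ∙                  r = r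
  ⌊⌋-context (within ζ Γ₁ Ξ Γ₂) r =
    ⌊⌋-local ζ Γ₁ (_ ∷ []) (_ ∷ []) Γ₂ (bracket⁺ (⌊⌋-context Ξ r))

  mutual
    ⌊⌋-≈ : ∀ {Ξ Ξ′} → Ξ S.≈ Ξ′ → ⌊ Ξ ⌋ ⟹ ⌊ Ξ′ ⌋
    ⌊⌋-≈ (p ⨾ ps) = ++⁺ (bangs-↭ p) (⌊⌋*-≈ ps)

    ⌊⌋*-≈ : ∀ {Γ Γ′} → Pointwise S._≈ₜ_ Γ Γ′ → ⌊ Γ ⌋* ⟹ ⌊ Γ′ ⌋*
    ⌊⌋*-≈ []       = ⟹-refl
    ⌊⌋*-≈ (p ∷ ps) = ++⁺ (⌊⌋ₜ-≈ p) (⌊⌋*-≈ ps)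

    ⌊⌋ₜ-≈ : ∀ {T T′} → T S.≈ₜ T′ → ⌊ T ⌋ₜ ∷ [] ⟹ ⌊ T′ ⌋ₜ ∷ []
    ⌊⌋ₜ-≈ fm    = ⟹-refl
    ⌊⌋ₜ-≈ [ p ] = bracket⁺ (⌊⌋-≈ p)

  -- Shared by the two left division rules. The embedded side premise leaves `bangs ζ₁` in the
  -- middle of the sequence, and `float` carries it out past `ζ₂` and `Δ₁`.
  gather : ∀ ζ₁ ζ₂ Δ₁ Δ₂ Θ Γ {Θ′} → ⌊ Θ ⌋* ⟹ Θ′ →
           (∀ Ψ → Ψ ++ Θ′ ++ ⌊ Δ₂ ⌋* ⟹ bangs ζ₁ ++ Ψ ++ ⌊ Γ ⌋* ++ ⌊ Δ₂ ⌋*) →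
           ⌊ ζ₂ ⨾ Δ₁ ++ Θ ++ Δ₂ ⌋ ⟹ ⌊ ζ₁ ++ ζ₂ ⨾ Δ₁ ++ Γ ++ Δ₂ ⌋
  gather ζ₁ ζ₂ Δ₁ Δ₂ Θ Γ {Θ′} r float =
    ≡⇒⟹ (focus ζ₂ Δ₁ Θ Δ₂)
    » ++⁺ˡ (bangs ζ₂) (++⁺ˡ ⌊ Δ₁ ⌋* (++⁺ʳ ⌊ Δ₂ ⌋* r))
    » ≡⇒⟹ (sym (++-assoc (bangs ζ₂) ⌊ Δ₁ ⌋* _))
    » float (bangs ζ₂ ++ ⌊ Δ₁ ⌋*)
    » ≡⇒⟹ (≡.trans (split ⌊ Δ₁ ⌋* (⌊ Γ ⌋* ++ ⌊ Δ₂ ⌋*)) (sym (focus (ζ₁ ++ ζ₂) Δ₁ Γ Δ₂)))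
    where
    split : ∀ Φ Ψ → bangs ζ₁ ++ (bangs ζ₂ ++ Φ) ++ Ψ ≡ bangs (ζ₁ ++ ζ₂) ++ Φ ++ Ψ
    split Φ Ψ = ≡.trans (assoc (bangs ζ₁) (bangs ζ₂))
                        (cong (_++ Φ ++ Ψ) (sym (map-++ _ ζ₁ ζ₂)))
      where
      assoc : ∀ b c → b ++ (c ++ Φ) ++ Ψ ≡ (b ++ c) ++ Φ ++ Ψ
      assoc b c = solve (++-monoid F.TreeTerm)

  -- `S.!L` becomes mere exchange, because a stoup formula already reads as a `!`-formula; it is
  -- `S.!P` that calls on `F.!L`.
  embed : ∀ {Ξ C} → Ξ S.⊢ C → ⌊ Ξ ⌋ F.⊢ C
  embed (S.conv p d) = apply (⌊⌋-≈ p) (embed d)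
  embed S.ax = F.ax
  embed (S.//L Ξ {ζ₁} {ζ₂} {Γ} {Δ₁} {Δ₂} {B} {C} d e) =
    apply (⌊⌋-context Ξ 
        (gather ζ₁ ζ₂ Δ₁ Δ₂ (fm C ∷ []) (fm (C // B) ∷ Γ) (//⟹ (embed d)) float)) (embed e)
    where
    float : ∀ Ψ → Ψ ++ (F.fm (C // B) ∷ bangs ζ₁ ++ ⌊ Γ ⌋*) ++ ⌊ Δ₂ ⌋*
                  ⟹ bangs ζ₁ ++ Ψ ++ F.fm (C // B) ∷ ⌊ Γ ⌋* ++ ⌊ Δ₂ ⌋*
    float Ψ = ≡⇒⟹ (assoc (F.fm (C // B) ∷ []) (bangs ζ₁) ⌊ Γ ⌋* ⌊ Δ₂ ⌋*)
              » bangs-float ζ₁ (Ψ ++ F.fm (C // B) ∷ []) (⌊ Γ ⌋* ++ ⌊ Δ₂ ⌋*)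
              » ++⁺ˡ (bangs ζ₁) (≡⇒⟹ (++-assoc Ψ _ _))
      where
      assoc : ∀ a b c d → Ψ ++ (a ++ b ++ c) ++ d ≡ (Ψ ++ a) ++ b ++ c ++ d
      assoc a b c d = solve (++-monoid F.TreeTerm)
  embed (S.//R {ζ} {Γ} {B} {C} ne d) = F.//R (⌊⌋-nonempty ne) (subst (F._⊢ C) snoc (embed d))
    where
    snoc : ⌊ ζ ⨾ Γ ++ fm B ∷ [] ⌋ ≡ ⌊ ζ ⨾ Γ ⌋ ++ F.fm B ∷ []
    snoc = ≡.trans (cong (bangs ζ ++_) (⌊⌋*-++ Γ _)) (sym (++-assoc (bangs ζ) ⌊ Γ ⌋* _))
  embed (S.\\L Ξ {ζ₁} {ζ₂} {Γ} {Δ₁} {Δ₂} {A} {C} d e) =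
    subst (λ Θ → ⌊ Ξ S.⟪ ζ₁ ++ ζ₂ ⨾ Δ₁ ++ Θ ⟫ ⌋ F.⊢ _) (++-assoc Γ _ Δ₂)
      (apply (⌊⌋-context Ξ
        (gather ζ₁ ζ₂ Δ₁ Δ₂ (fm C ∷ []) (Γ ++ fm (A \\ C) ∷ []) (\\⟹ (embed d)) float)) (embed e))
    where
    float : ∀ Ψ → Ψ ++ ((bangs ζ₁ ++ ⌊ Γ ⌋*) ++ F.fm (A \\ C) ∷ []) ++ ⌊ Δ₂ ⌋*
                  ⟹ bangs ζ₁ ++ Ψ ++ ⌊ Γ ++ fm (A \\ C) ∷ [] ⌋* ++ ⌊ Δ₂ ⌋*
    float Ψ = ≡⇒⟹ (assoc (F.fm (A \\ C) ∷ []) (bangs ζ₁) ⌊ Γ ⌋* ⌊ Δ₂ ⌋*)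
              » bangs-float ζ₁ Ψ ((⌊ Γ ⌋* ++ F.fm (A \\ C) ∷ []) ++ ⌊ Δ₂ ⌋*)
              » ≡⇒⟹ (cong (λ Θ → bangs ζ₁ ++ Ψ ++ Θ ++ ⌊ Δ₂ ⌋*) (sym (⌊⌋*-++ Γ _)))
      where
      assoc : ∀ a b c d → Ψ ++ ((b ++ c) ++ a) ++ d ≡ Ψ ++ b ++ (c ++ a) ++ d
      assoc a b c d = solve (++-monoid F.TreeTerm)
  embed (S.\\R {ζ} {Γ} {A} ne d) =
    F.\\R (⌊⌋-nonempty ne) (apply (bangs-sink ζ (F.fm A ∷ []) ⌊ Γ ⌋*) (embed d))
  embed (S.·L Ξ {ζ} {Δ₁} {Δ₂} {A} {B} d) =
    apply (⌊⌋-context Ξ (⌊⌋-local ζ Δ₁ (fm A ∷ fm B ∷ []) (fm (A · B) ∷ []) Δ₂ ·⟹)) (embed d)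
  embed (S.·R {ζ₁} {ζ₂} {Δ} {Γ} d e) =
    apply (≡⇒⟹ (++-assoc (bangs ζ₁) ⌊ Δ ⌋* _)
           » ++⁺ˡ (bangs ζ₁) (bangs-float ζ₂ ⌊ Δ ⌋* ⌊ Γ ⌋*)
           » ≡⇒⟹ (≡.trans (sym (++-assoc (bangs ζ₁) (bangs ζ₂) _))
                          (cong₂ _++_ (sym (map-++ _ ζ₁ ζ₂)) (sym (⌊⌋*-++ Δ Γ)))))
          (F.·R (embed d) (embed e))
  embed (S.[]⁻¹L Ξ {ζ} {Δ₁} {Δ₂} {A} d) =
    apply (⌊⌋-context Ξ (⌊⌋-local ζ Δ₁ (fm A ∷ []) ([ [] ⨾ fm ([]⁻¹ A) ∷ [] ] ∷ []) Δ₂ []⁻¹⟹)) (embed d)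
  embed (S.[]⁻¹R d) = F.[]⁻¹R (embed d)
  embed (S.⟨⟩L Ξ {ζ} {Δ₁} {Δ₂} {A} d) =
    apply (⌊⌋-context Ξ (⌊⌋-local ζ Δ₁ ([ [] ⨾ fm A ∷ [] ] ∷ []) (fm (⟨⟩ A) ∷ []) Δ₂ ⟨⟩⟹)) (embed d)
  embed (S.⟨⟩R d) = F.⟨⟩R (embed d)
  embed (S.!L Ξ {ζ} {Γ₁} {Γ₂} {A} d) =
    apply (⌊⌋-context Ξ {A ∷ ζ ⨾ Γ₁ ++ Γ₂} {ζ ⨾ Γ₁ ++ fm (! A) ∷ Γ₂}
      (≡⇒⟹ (cong (F.fm (! A) ∷_) (≡.trans (focus ζ Γ₁ [] Γ₂) (sym (++-assoc (bangs ζ) _ _))))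
       » bangs-sink (A ∷ []) (bangs ζ ++ ⌊ Γ₁ ⌋*) ⌊ Γ₂ ⌋*
       » ≡⇒⟹ (≡.trans (++-assoc (bangs ζ) _ _) (sym (focus ζ Γ₁ (fm (! A) ∷ []) Γ₂))))) (embed d)
  embed (S.!P Ξ {ζ} {Γ₁} {Γ₂} {A} d) =
    apply (⌊⌋-context Ξ {ζ ⨾ Γ₁ ++ fm A ∷ Γ₂} {A ∷ ζ ⨾ Γ₁ ++ Γ₂}
      (⌊⌋-local ζ Γ₁ (fm A ∷ []) (fm (! A) ∷ []) Γ₂ !⟹
       » ≡⇒⟹ (≡.trans (focus ζ Γ₁ (fm (! A) ∷ []) Γ₂) (sym (++-assoc (bangs ζ) _ _)))
       » bangs-float (A ∷ []) (bangs ζ ++ ⌊ Γ₁ ⌋*) ⌊ Γ₂ ⌋*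
       » ≡⇒⟹ (cong (F.fm (! A) ∷_) (≡.trans (++-assoc (bangs ζ) _ _) (sym (focus ζ Γ₁ [] Γ₂)))))) (embed d)
  embed (S.!R′ d) = F.!R (embed d)
  embed (S.!C′ Ξ {ζ} {ζ′} {Γ₁} {Γ₂} {Γ₃} {A} ne d) =
    apply (⌊⌋-context Ξ {A ∷ ζ ⨾ Γ₁ ++ [ A ∷ ζ′ ⨾ Γ₂ ] ∷ Γ₃} {A ∷ ζ ⨾ Γ₁ ++ [ [] ⨾ [ ζ′ ⨾ Γ₂ ] ∷ [] ] ∷ Γ₃}
      (≡⇒⟹ (cong (F.fm (! A) ∷_) (split [ A ∷ ζ′ ⨾ Γ₂ ]))
       » contract A (bangs ζ ++ ⌊ Γ₁ ⌋*) ⌊ Γ₃ ⌋* (⌊⌋-nonempty ne)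
       » ≡⇒⟹ (cong (F.fm (! A) ∷_) (sym (split [ [] ⨾ [ ζ′ ⨾ Γ₂ ] ∷ [] ]))))) (embed d)
    where
    split : ∀ T → ⌊ ζ ⨾ Γ₁ ++ T ∷ Γ₃ ⌋ ≡ (bangs ζ ++ ⌊ Γ₁ ⌋*) ++ ⌊ T ⌋ₜ ∷ ⌊ Γ₃ ⌋*
    split T = ≡.trans (focus ζ Γ₁ (T ∷ []) Γ₃) (sym (++-assoc (bangs ζ) _ _))

  mutual
    debracket-⌊⌋ : ∀ {Ξ} → S.Stoupless Ξ → F.debracket ⌊ Ξ ⌋ ≡ S.debracket Ξ
    debracket-⌊⌋ (S.[]⨾ ps) = debracket-⌊⌋* ps

    debracket-⌊⌋* : ∀ {Γ} → All S.StouplessTerm Γ → F.debracket ⌊ Γ ⌋* ≡ S.debracketAll Γ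
    debracket-⌊⌋* []                = refl
    debracket-⌊⌋* (S.fm A    ∷ ps) = cong (A ∷_) (debracket-⌊⌋* ps)
    debracket-⌊⌋* ((S.[ p ]) ∷ ps) = cong₂ _++_ (debracket-⌊⌋ p) (debracket-⌊⌋* ps)

-- Soundness of the stoup-free calculus for predicate transformers

record Transformer (X : Set) : Set₁ where
  constructor transformer
  field
    apply : Pred X 0ℓ → Pred X 0ℓ
    mono  : ∀ {P Q} → P ⊆ Q → apply P ⊆ apply Q

-- Composition of transformers is associative and unital up to definitional
-- equality, by η for functions and records.
module Semantics {X : Set} (valuation : ℕ → Transformer X) where
  open Transformer
  open F

  infixr 9 _∙′_
  infix 4 _≤_

  _∙′_ : Transformer X → Transformer X → Transformer X
  apply (a ∙′ b) = apply a ∘ apply b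
  mono (a ∙′ b) = λ P⊆Q → mono a (mono b P⊆Q)

  𝟙 : Transformer X
  𝟙 = transformer id (λ P⊆Q → P⊆Q)

  _≤_ : Transformer X → Transformer X → Set₁
  a ≤ b = ∀ P → apply a P ⊆ apply b P

  ≤-refl : ∀ a → a ≤ a
  ≤-refl a P p = p

  UpClosed : Pred (Transformer X) (suc 0ℓ) → Set₁
  UpClosed U = ∀ {a b} → a ≤ b → U a → U b

  -- Brackets are invisible.  The value of ! A is either empty or the principal
  -- up-set of 𝟙, hence central and idempotent.
  ⟦_⟧ : Formula → Pred (Transformer X) (suc 0ℓ)
  ⟦ var n ⟧  x = valuation n ≤ x
  ⟦ A \\ C ⟧ x = ∀ a → ⟦ A ⟧ a → ⟦ C ⟧ (a ∙′ x)
  ⟦ C // B ⟧ x = ∀ b → ⟦ B ⟧ b → ⟦ C ⟧ (x ∙′ b)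
  ⟦ A · B ⟧  x = ∃[ a ] ∃[ b ] ⟦ A ⟧ a × ⟦ B ⟧ b × a ∙′ b ≤ x
  ⟦ ⟨⟩ A ⟧     = ⟦ A ⟧
  ⟦ []⁻¹ A ⟧   = ⟦ A ⟧
  ⟦ ! A ⟧    x = ⟦ A ⟧ 𝟙 × 𝟙 ≤ x

  ⟦⟧-up : ∀ A → UpClosed ⟦ A ⟧
  ⟦⟧-up (var n)  x≤y vx P p = x≤y P (vx P p)
  ⟦⟧-up (A \\ C) x≤y f a a∈A = ⟦⟧-up C (λ P p → mono a (x≤y P) p) (f a a∈A)
  ⟦⟧-up (C // B) x≤y f b b∈B = ⟦⟧-up C (λ P p → x≤y (apply b P) p) (f b b∈B)
  ⟦⟧-up (A · B)  x≤y (a , b , a∈A , b∈B , ab≤x) = a , b , a∈A , b∈B , λ P p → x≤y P (ab≤x P p)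
  ⟦⟧-up (⟨⟩ A)   = ⟦⟧-up A
  ⟦⟧-up ([]⁻¹ A) = ⟦⟧-up A
  ⟦⟧-up (! A)    x≤y (𝟙∈A , 𝟙≤x) = 𝟙∈A , λ P p → x≤y P (𝟙≤x P p)

  -- U contains all composites of members of the values in Γ.  The continuation
  -- form spares an existential over decompositions.
  Every : Meta → Pred (Transformer X) (suc 0ℓ) → Set₁
  Every []         U = U 𝟙
  Every (fm A ∷ Γ) U = ∀ a → ⟦ A ⟧ a → Every Γ (λ x → U (a ∙′ x))
  Every ([ Ξ ] ∷ Γ) U = Every Ξ (λ x → Every Γ (λ y → U (x ∙′ y)))

  Every-map : ∀ Γ {U V} → (∀ x → U x → V x) → Every Γ U → Every Γ V
  Every-map []          f u = f 𝟙 u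
  Every-map (fm A ∷ Γ)  f h a a∈A = Every-map Γ (λ x → f (a ∙′ x)) (h a a∈A)
  Every-map ([ Ξ ] ∷ Γ) f = Every-map Ξ (λ x → Every-map Γ (λ y → f (x ∙′ y)))

  Every-++⁺ : ∀ Γ Δ {U} → Every Γ (λ x → Every Δ (λ y → U (x ∙′ y))) → Every (Γ ++ Δ) U
  Every-++⁺ []          Δ h = h
  Every-++⁺ (fm A ∷ Γ)  Δ h a a∈A = Every-++⁺ Γ Δ (h a a∈A)
  Every-++⁺ ([ Ξ ] ∷ Γ) Δ = Every-map Ξ (λ x → Every-++⁺ Γ Δ)

  Every-++⁻ : ∀ Γ Δ {U} → Every (Γ ++ Δ) U → Every Γ (λ x → Every Δ (λ y → U (x ∙′ y)))
  Every-++⁻ []          Δ h = h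
  Every-++⁻ (fm A ∷ Γ)  Δ h a a∈A = Every-++⁻ Γ Δ (h a a∈A)
  Every-++⁻ ([ Ξ ] ∷ Γ) Δ = Every-map Ξ (λ x → Every-++⁻ Γ Δ)

  infix 4 _⊑_

  -- Only up-closed `U` are tested, because `·` and `!` are interpreted up to `≤`; the value of
  -- every formula is such a `U`.
  record _⊑_ (Θ′ Θ : Meta) : Set₂ where
    constructor entails
    field
      transfer : ∀ {U} → UpClosed U → Every Θ U → Every Θ′ U

  open _⊑_

  ⊑-++ : ∀ Δ₁ {Θ′ Θ} Δ₂ → Θ′ ⊑ Θ → Δ₁ ++ Θ′ ++ Δ₂ ⊑ Δ₁ ++ Θ ++ Δ₂
  transfer (⊑-++ Δ₁ {Θ′} {Θ} Δ₂ r) up =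
    Every-++⁺ Δ₁ (Θ′ ++ Δ₂)
    ∘ Every-map Δ₁ (λ a → Every-++⁺ Θ′ Δ₂
                      ∘ transfer r (λ x≤y → Every-map Δ₂ (λ b → up (λ P p → mono a (x≤y (apply b P)) p)))
                      ∘ Every-++⁻ Θ Δ₂)
    ∘ Every-++⁻ Δ₁ (Θ ++ Δ₂)

  ⊑-context : ∀ Ξ {Θ′ Θ} → Θ′ ⊑ Θ → Ξ ⟪ Θ′ ⟫ ⊑ Ξ ⟪ Θ ⟫
  ⊑-context ∙                r = r
  ⊑-context (within Γ₁ Ξ Γ₂) {Θ′} {Θ} r = ⊑-++ Γ₁ Γ₂ bracketed
    where
    bracketed : [ Ξ ⟪ Θ′ ⟫ ] ∷ [] ⊑ [ Ξ ⟪ Θ ⟫ ] ∷ []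
    transfer bracketed = transfer (⊑-context Ξ r)

  sound-local : ∀ Ξ Δ₁ {Θ′ Θ} Δ₂ C → Θ′ ⊑ Θ →
                Every (Ξ ⟪ Δ₁ ++ Θ ++ Δ₂ ⟫) ⟦ C ⟧ → Every (Ξ ⟪ Δ₁ ++ Θ′ ++ Δ₂ ⟫) ⟦ C ⟧
  sound-local Ξ Δ₁ Δ₂ C r = transfer (⊑-context Ξ (⊑-++ Δ₁ Δ₂ r)) (⟦⟧-up C)

  -- `Every` is a nested universal quantification, so another one can be pulled through it.
  Every-Π : ∀ Γ {H : Set₁} {U : H → Pred (Transformer X) (suc 0ℓ)} → (∀ h → Every Γ (U h)) → Every Γ (λ x → ∀ h → U h x)
  Every-Π []          f = f
  Every-Π (fm A ∷ Γ)  f a a∈A = Every-Π Γ (λ h → f h a a∈A)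
  Every-Π ([ Ξ ] ∷ Γ) f = Every-map Ξ (λ x → Every-Π Γ) (Every-Π Ξ f)

  -- By up-closure `! A` may be replaced by its least possible value `𝟙`, which commutes with
  -- everything. What remains is the proof that `𝟙` lies in `⟦ A ⟧`, and `Every-Π` moves it across
  -- `Φ`.
  bang-right : ∀ A Φ → Φ ++ fm (! A) ∷ [] ⊑ fm (! A) ∷ Φ
  transfer (bang-right A Φ) up h = Every-++⁺ Φ (fm (! A) ∷ [])
    (Every-map Φ (λ x u a (𝟙∈A , 𝟙≤a) → up (λ P p → mono x (𝟙≤a P) p) (u 𝟙∈A))
      (Every-Π Φ (λ 𝟙∈A → h 𝟙 (𝟙∈A , ≤-refl 𝟙))))

  bang-left : ∀ A Φ → fm (! A) ∷ Φ ⊑ Φ ++ fm (! A) ∷ []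
  transfer (bang-left A Φ) up h a (𝟙∈A , 𝟙≤a) =
    Every-map Φ (λ x u → up (λ P p → 𝟙≤a (Transformer.apply x P) p) (u 𝟙 (𝟙∈A , ≤-refl 𝟙)))
      (Every-++⁻ Φ (fm (! A) ∷ []) h)

  -- The inner copy is given the value `𝟙`, which belongs to `! A` as soon as the outer copy has any
  -- value at all.
  contraction : ∀ A Γ₁ Γ₂ Γ₃ → fm (! A) ∷ Γ₁ ++ [ [ Γ₂ ] ∷ [] ] ∷ Γ₃
                               ⊑ fm (! A) ∷ Γ₁ ++ [ fm (! A) ∷ Γ₂ ] ∷ Γ₃
  transfer (contraction A Γ₁ Γ₂ Γ₃) up h a (𝟙∈A , 𝟙≤a) =
    Every-++⁺ Γ₁ ([ [ Γ₂ ] ∷ [] ] ∷ Γ₃) (Every-map Γ₁ (λ x u → u 𝟙 (𝟙∈A , ≤-refl 𝟙))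
      (Every-++⁻ Γ₁ ([ fm (! A) ∷ Γ₂ ] ∷ Γ₃) (h a (𝟙∈A , 𝟙≤a))))

  soundness : ∀ {Ξ C} → Ξ ⊢ C → Every Ξ ⟦ C ⟧
  soundness ax a a∈A = a∈A
  soundness {C = D} (//L Ξ {Γ} {Δ₁} {Δ₂} {B} {C} d e) = sound-local Ξ Δ₁ Δ₂ D local (soundness e)
    where
    local : fm (C // B) ∷ Γ ⊑ fm C ∷ []
    transfer local _ h x x∈C//B = Every-map Γ (λ b b∈B → h (x ∙′ b) (x∈C//B b b∈B)) (soundness d)
  soundness (//R {Γ} {B} _ d) = Every-++⁻ Γ (fm B ∷ []) (soundness d)
  soundness {C = D} (\\L Ξ {Γ} {Δ₁} {Δ₂} {A} {C} d e) =
    subst (λ Θ → Every (Ξ ⟪ Δ₁ ++ Θ ⟫) ⟦ D ⟧) (++-assoc Γ _ Δ₂) (sound-local Ξ Δ₁ Δ₂ D local (soundness e))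
    where
    local : Γ ++ fm (A \\ C) ∷ [] ⊑ fm C ∷ []
    transfer local _ h = Every-++⁺ Γ (fm (A \\ C) ∷ [])
      (Every-map Γ (λ a a∈A x x∈A\\C → h (a ∙′ x) (x∈A\\C a a∈A)) (soundness d))
  soundness (\\R {Γ} {A} _ d) = Every-Π Γ (λ a → Every-Π Γ (soundness d a))
  soundness {C = D} (·L Ξ {Δ₁} {Δ₂} {A} {B} d) = sound-local Ξ Δ₁ Δ₂ D local (soundness d)
    where
    local : fm (A · B) ∷ [] ⊑ fm A ∷ fm B ∷ []
    transfer local up h x (a , b , a∈A , b∈B , ab≤x) = up ab≤x (h a a∈A b b∈B)
  soundness (·R {Δ} {Γ} d e) = Every-++⁺ Δ Γ
    (Every-map Δ (λ a a∈A → Every-map Γ (λ b b∈B → a , b , a∈A , b∈B , ≤-refl (a ∙′ b)) (soundness e))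
      (soundness d))
  soundness {C = D} ([]⁻¹L Ξ {Δ₁} {Δ₂} d) = sound-local Ξ Δ₁ Δ₂ D (entails λ _ h → h) (soundness d)
  soundness ([]⁻¹R d) = soundness d
  soundness {C = D} (⟨⟩L Ξ {Δ₁} {Δ₂} d) = sound-local Ξ Δ₁ Δ₂ D (entails λ _ h → h) (soundness d)
  soundness (⟨⟩R d) = soundness d
  soundness {C = D} (!L Ξ {Δ₁} {Δ₂} {A} d) = sound-local Ξ Δ₁ Δ₂ D local (soundness d)
    where
    local : fm (! A) ∷ [] ⊑ fm A ∷ []
    transfer local _ h a (𝟙∈A , 𝟙≤a) = h a (⟦⟧-up A 𝟙≤a 𝟙∈A)
  soundness {C = D} (!P₁ Ξ {Δ₁} {Φ} {Δ₂} {A} d) =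
    subst (λ Θ → Every (Ξ ⟪ Δ₁ ++ Θ ⟫) ⟦ D ⟧) (++-assoc Φ _ Δ₂)
      (sound-local Ξ Δ₁ Δ₂ D (bang-right A Φ) (soundness d))
  soundness {C = D} (!P₂ Ξ {Δ₁} {Φ} {Δ₂} {A} d) =
    sound-local Ξ Δ₁ Δ₂ D (bang-left A Φ)
      (subst (λ Θ → Every (Ξ ⟪ Δ₁ ++ Θ ⟫) ⟦ D ⟧) (sym (++-assoc Φ _ Δ₂)) (soundness d))
  -- `! B` asks for `B` at `𝟙` itself, which the premise yields when its antecedent takes the value
  -- `𝟙`.
  soundness (!R d) a (𝟙∈A , 𝟙≤a) = soundness d 𝟙 (𝟙∈A , ≤-refl 𝟙) , 𝟙≤a
  soundness {C = D} (!C Ξ {Γ₁} {Γ₂} {Γ₃} {A} _ d) =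
    transfer (⊑-context Ξ (contraction A Γ₁ Γ₂ Γ₃)) (⟦⟧-up D) (soundness d)
  soundness {C = D} (cut Ξ {Π} {Γ₁} {Γ₂} {A} d e) = sound-local Ξ Γ₁ Γ₂ D local (soundness e)
    where
    local : Π ⊑ fm A ∷ []
    transfer local _ h = Every-map Π h (soundness d)

  -- This reduces t-recognition to the flat word: whatever brackets a derivation uses, its meaning
  -- is a statement about the sequence without them.
  Every-debracket : ∀ Γ {U} → Every Γ U → Every (map fm (debracket Γ)) U
  Every-debracket []          h = h
  Every-debracket (fm A ∷ Γ)  h a a∈A = Every-debracket Γ (h a a∈A)
  Every-debracket ([ Ξ ] ∷ Γ) {U} h =
    subst (λ Δ → Every Δ U) (sym (map-++ fm (debracket Ξ) (debracket Γ)))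
      (Every-++⁺ (map fm (debracket Ξ)) _
        (Every-map (map fm (debracket Ξ)) (λ x → Every-debracket Γ) (Every-debracket Ξ h)))

-- Simulating semi-Thue systems with stoups

-- There is no empty product, so what follows the head on the left side, and the whole right side,
-- must be nonempty.
record Rewrite (L : Set) : Set where
  field
    head next : L
    rest      : List L
    out       : L
    outs      : List L

  lhs rhs : List L
  lhs = head ∷ next ∷ rest
  rhs = out ∷ outs

infix 3 _⊢_⇒_ _⊢_⇒*_

data _⊢_⇒_ {L : Set} (rules : List (Rewrite L)) : List L → List L → Set where
  here : ∀ {r} → r ∈ rules → ∀ v → rules ⊢ Rewrite.lhs r ++ v ⇒ Rewrite.rhs r ++ v
  skip : ∀ {x u v} → rules ⊢ u ⇒ v → rules ⊢ x ∷ u ⇒ x ∷ v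

_⊢_⇒*_ : {L : Set} (rules : List (Rewrite L)) → List L → List L → Set
rules ⊢ u ⇒* v = Star (rules ⊢_⇒_) u v

⨂ : Formula → List Formula → Formula
⨂ A []       = A
⨂ A (B ∷ As) = A · ⨂ B As

module Encoding {L : Set} (code : L → ℕ) where

  -- The double bracket produced by ⟨⟩ ⟨⟩ is what contraction consumes when it
  -- brings a rule to the letter.
  letter : L → Formula
  letter x = ⟨⟩ ⟨⟩ var (code x)

  ruleFormula : Rewrite L → Formula
  ruleFormula r =
    var (code head) \\ []⁻¹ (⨂ (letter out) (map letter outs) // ⨂ (letter next) (map letter rest))
    where open Rewrite r

  bangProduct : Rewrite L → List (Rewrite L) → Formula
  bangProduct r rs = ⨂ (! ruleFormula r) (map (!_ ∘ ruleFormula) rs)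

  -- The factor bangProduct on the right discharges the rules left over in the
  -- stoup, as there is no weakening.
  goalFormula : L → L → L → L → Rewrite L → List (Rewrite L) → Formula
  goalFormula l q e f r rs =
    (letter l · letter q) \\ ((letter f · bangProduct r rs) // (letter e · bangProduct r rs))

  -- Derivations from rewriting sequences

  module Simulation where
    open S

    mutual
      ≈-refl : ∀ Ξ → Ξ ≈ Ξ
      ≈-refl (ζ ⨾ Γ) = refl ⨾ ≈*-refl Γ

      ≈*-refl : ∀ Γ → Pointwise _≈ₜ_ Γ Γ
      ≈*-refl []          = []
      ≈*-refl (fm A ∷ Γ)  = fm ∷ ≈*-refl Γ
      ≈*-refl ([ Ξ ] ∷ Γ) = [ ≈-refl Ξ ] ∷ ≈*-refl Γ

    permute : ∀ {ζ ζ′ Γ C} → ζ ↭ ζ′ → ζ ⨾ Γ ⊢ C → ζ′ ⨾ Γ ⊢ C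
    permute p = conv (p ⨾ ≈*-refl _)

    retype : ∀ {ζ Γ Γ′ C} → Γ ≡ Γ′ → ζ ⨾ Γ ⊢ C → ζ ⨾ Γ′ ⊢ C
    retype refl d = d

    reassoc : ∀ {ζ C} Δ {T} Γ → ζ ⨾ Δ ++ T ∷ Γ ⊢ C → ζ ⨾ (Δ ++ T ∷ []) ++ Γ ⊢ C
    reassoc Δ Γ = retype (sym (++-assoc Δ _ Γ))

    unassoc : ∀ {ζ C} Δ {T} Γ → ζ ⨾ (Δ ++ T ∷ []) ++ Γ ⊢ C → ζ ⨾ Δ ++ T ∷ Γ ⊢ C
    unassoc Δ Γ = retype (++-assoc Δ _ Γ)

    ⨂R : ∀ A As → [] ⨾ map fm (A ∷ As) ⊢ ⨂ A As
    ⨂R A []       = ax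
    ⨂R A (B ∷ As) = ·R ax (⨂R B As)

    ⨂L : ∀ {ζ C} Δ A As Γ → ζ ⨾ Δ ++ map fm (A ∷ As) ++ Γ ⊢ C → ζ ⨾ Δ ++ fm (⨂ A As) ∷ Γ ⊢ C
    ⨂L Δ A []       Γ d = d
    ⨂L Δ A (B ∷ As) Γ d =
      ·L ∙ (unassoc Δ _ (⨂L (Δ ++ fm A ∷ []) B As Γ (reassoc Δ _ d)))

    -- Contraction spends a copy of the rule and leaves the original in the stoup, so `ζ` is the
    -- same on both sides and rules can be reused without limit.
    applyRule : ∀ {ζ Δ Γ C} r → ruleFormula r ∈ ζ → let open Rewrite r in
                ζ ⨾ Δ ++ map fm (map letter rhs) ++ Γ ⊢ C →
                ζ ⨾ Δ ++ map fm (map letter lhs) ++ Γ ⊢ C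
    applyRule {ζ} {Δ} {Γ} {C} r r∈ζ d with ys , zs , eq ← ∈-∃++ r∈ζ =
      ⟨⟩L ∙ (⟨⟩L (within ζ Δ ∙ Λ) {Δ₁ = []} (permute (↭-sym front)
        (!C′ ∙ (inj₁ λ ())
          -- The copy is placed to the right of the variable, since its division takes its argument
          -- from the left.
          (!P (within (ruleFormula r ∷ ys ++ zs) Δ ∙ Λ) {Γ₁ = fm (var (code head)) ∷ []} {Γ₂ = []}
            (\\L (within (ruleFormula r ∷ ys ++ zs) Δ ∙ Λ) {Δ₁ = []} ax
              ([]⁻¹L ∙ {Δ₁ = Δ}
                (//L ∙ {ζ₁ = []} (⨂R (letter next) (map letter rest))
                  (⨂L Δ (letter out) (map letter outs) Γ (permute front d)))))))))
      where
      open Rewrite r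
      Λ : List TreeTerm
      Λ = map fm (map letter (next ∷ rest)) ++ Γ

      front : ζ ↭ ruleFormula r ∷ ys ++ zs
      front rewrite eq = shift (ruleFormula r) ys zs

    simulate : ∀ {ζ rules u v Γ C} Δ → (∀ {r} → r ∈ rules → ruleFormula r ∈ ζ) → rules ⊢ u ⇒ v →
               ζ ⨾ Δ ++ map fm (map letter v) ++ Γ ⊢ C → ζ ⨾ Δ ++ map fm (map letter u) ++ Γ ⊢ C
    simulate {Γ = Γ} Δ sub (here {r} r∈rules v) d =
      retype (cong (Δ ++_) (sym (split lhs)))
        (applyRule {Δ = Δ} r (sub r∈rules) (retype (cong (Δ ++_) (split rhs)) d))
      where
      open Rewrite r
      split : ∀ u → map fm (map letter (u ++ v)) ++ Γ
                    ≡ map fm (map letter u) ++ map fm (map letter v) ++ Γ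
      split u = ≡.trans (cong (λ As → map fm As ++ Γ) (map-++ letter u v))
                (≡.trans (cong (_++ Γ) (map-++ fm (map letter u) (map letter v)))
                         (++-assoc (map fm (map letter u)) _ Γ))
    simulate {Γ = Γ} Δ sub (skip {x} u⇒v) d =
      unassoc Δ _ (simulate (Δ ++ fm (letter x) ∷ []) sub u⇒v (reassoc Δ _ d))

    simulate* : ∀ {ζ rules u v C} → (∀ {r} → r ∈ rules → ruleFormula r ∈ ζ) → rules ⊢ u ⇒* v →
                ζ ⨾ map fm (map letter v) ++ [] ⊢ C → ζ ⨾ map fm (map letter u) ++ [] ⊢ C
    simulate* sub ε          d = d
    simulate* sub (s ◅ u⇒*v) d = simulate [] sub s (simulate* sub u⇒*v d)

    stash : ∀ {C} Γ rs → map ruleFormula rs ⨾ Γ ⊢ C →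
            [] ⨾ Γ ++ map fm (map (!_ ∘ ruleFormula) rs) ++ [] ⊢ C
    stash Γ []       d = retype (sym (++-identityʳ Γ)) d
    stash Γ (r ∷ rs) d =
      unassoc Γ _ (stash (Γ ++ fm (! ruleFormula r) ∷ []) rs
        (!L ∙ {Γ₁ = Γ} {Γ₂ = []} (retype (sym (++-identityʳ Γ)) d)))

    bangProductL : ∀ {C} Γ r rs → map ruleFormula (r ∷ rs) ⨾ Γ ⊢ C →
                   [] ⨾ Γ ++ fm (bangProduct r rs) ∷ [] ⊢ C
    bangProductL Γ r rs d = ⨂L Γ _ (map (!_ ∘ ruleFormula) rs) [] (stash Γ (r ∷ rs) d)

    -- `!R′` demands a stoup of exactly one formula, so `·R` hands one rule to each factor.
    bangProductR : ∀ r rs → map ruleFormula (r ∷ rs) ⨾ [] ⊢ bangProduct r rs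
    bangProductR r []        = !R′ (!P ∙ {Γ₁ = []} ax)
    bangProductR r (r′ ∷ rs) = ·R (!R′ (!P ∙ {Γ₁ = []} ax)) (bangProductR r′ rs)

    recognise : ∀ {l q e f r rs w} → w ≢ [] → (r ∷ rs) ⊢ l ∷ q ∷ w ++ e ∷ [] ⇒* f ∷ [] →
                [] ⨾ map fm (map letter w) ⊢ goalFormula l q e f r rs
    recognise {w = []} w≢[] _ with () ← w≢[] refl
    -- The antecedent of the outermost right rule is `w` alone with an empty stoup, so its side
    -- condition is where a nonempty word is required.
    recognise {l} {q} {e} {f} {r} {rs} {w@(_ ∷ _)} _ run =
      \\R (inj₁ λ ()) (//R (inj₁ λ ()) (·L ∙ {Δ₁ = []} (·L ∙ {Δ₁ = Γ} (unassoc Γ _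
        (bangProductL (Γ ++ fm (letter e) ∷ []) r rs
          (retype regroup
            (simulate* (∈-map⁺ ruleFormula) run (·R {Δ = fm (letter f) ∷ []} ax (bangProductR r rs)))))))))
      where
      Γ : List TreeTerm
      Γ = map fm (map letter (l ∷ q ∷ w))

      regroup : map fm (map letter (l ∷ q ∷ w ++ e ∷ [])) ++ [] ≡ Γ ++ fm (letter e) ∷ []
      regroup = ≡.trans (++-identityʳ _)
        (≡.trans (cong (map fm) (map-++ letter (l ∷ q ∷ w) (e ∷ []))) (map-++ fm (map letter (l ∷ q ∷ w)) _))

-- Semantics of the encoded rewriting system

module Interpretation {L : Set} (code : L → ℕ) (code-injective : ∀ {x y} → code x ≡ code y → x ≡ y)
                      {X : Set} (act : L → Transformer X) where
  open Encoding code
  open Transformer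

  -- The existential stands in for decoding `n`: by injectivity at most one letter qualifies, and
  -- off the range of `code` the result is empty.
  valuation : ℕ → Transformer X
  apply (valuation n) P x = ∃[ y ] code y ≡ n × apply (act y) P x
  mono (valuation n) P⊆Q (y , eq , p) = y , eq , mono (act y) P⊆Q p

  open Semantics valuation

  ⟦_⟧* : List L → Transformer X
  ⟦ [] ⟧*    = 𝟙
  ⟦ x ∷ u ⟧* = act x ∙′ ⟦ u ⟧*

  ⟦⟧*-++ : ∀ u v → ⟦ u ++ v ⟧* ≡ ⟦ u ⟧* ∙′ ⟦ v ⟧*
  ⟦⟧*-++ []      v = refl
  ⟦⟧*-++ (x ∷ u) v = cong (act x ∙′_) (⟦⟧*-++ u v)

  letter⁺ : ∀ x a → act x ≤ a → ⟦ letter x ⟧ a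
  letter⁺ x a x≤a P (y , eq , p) with refl ← code-injective eq = x≤a P p

  letter⁻ : ∀ x a → ⟦ letter x ⟧ a → act x ≤ a
  letter⁻ x a h P p = h P (x , refl , p)

  ⨂⁺ : ∀ x u a → ⟦ x ∷ u ⟧* ≤ a → ⟦ ⨂ (letter x) (map letter u) ⟧ a
  ⨂⁺ x []      a xu≤a = letter⁺ x a xu≤a
  ⨂⁺ x (y ∷ u) a xu≤a =
    act x , ⟦ y ∷ u ⟧* , letter⁺ x (act x) (≤-refl (act x)) , ⨂⁺ y u ⟦ y ∷ u ⟧* (≤-refl ⟦ y ∷ u ⟧*) , xu≤a

  ⨂⁻ : ∀ x u a → ⟦ ⨂ (letter x) (map letter u) ⟧ a → ⟦ x ∷ u ⟧* ≤ a
  ⨂⁻ x []      a h = letter⁻ x a h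
  ⨂⁻ x (y ∷ u) a (b , c , b∈x , c∈u , bc≤a) P p =
    bc≤a P (letter⁻ x b b∈x (apply c P) (mono (act x) (⨂⁻ y u c c∈u P) p))

  Sound : Rewrite L → Set₁
  Sound r = ⟦ Rewrite.rhs r ⟧* ≤ ⟦ Rewrite.lhs r ⟧*

  -- Membership of `𝟙` asks that `a ∙′ b` lie above the right side; by monotonicity `a ∙′ b` lies
  -- above the left side, and `Sound` does the rest.
  ruleFormula⁺ : ∀ r → Sound r → ⟦ ruleFormula r ⟧ 𝟙
  ruleFormula⁺ r sound a a∈head b b∈tail = ⨂⁺ out outs (a ∙′ b) λ P p →
    letter⁻ head a a∈head (apply b P) (mono (act head) (⨂⁻ next rest b b∈tail P) (sound P p))
    where open Rewrite r

  bangProduct⁺ : ∀ r rs → (∀ {r′} → r′ ∈ r ∷ rs → Sound r′) → ⟦ bangProduct r rs ⟧ 𝟙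
  bangProduct⁺ r []        sound = ruleFormula⁺ r (sound (here refl)) , ≤-refl 𝟙
  bangProduct⁺ r (r′ ∷ rs) sound =
    𝟙 , 𝟙 , (ruleFormula⁺ r (sound (here refl)) , ≤-refl 𝟙) , bangProduct⁺ r′ rs (sound ∘ there) , ≤-refl 𝟙

  bangProduct⁻ : ∀ r rs a → ⟦ bangProduct r rs ⟧ a → 𝟙 ≤ a
  bangProduct⁻ r []        a (_ , 𝟙≤a) = 𝟙≤a
  bangProduct⁻ r (r′ ∷ rs) a (b , c , (_ , 𝟙≤b) , c∈ , bc≤a) P p =
    bc≤a P (𝟙≤b (apply c P) (bangProduct⁻ r′ rs c c∈ P p))

  Every-letters : ∀ w {U} → Every (map F.fm (map letter w)) U → U ⟦ w ⟧*
  Every-letters []      h = h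
  Every-letters (x ∷ w) h = Every-letters w (h (act x) (letter⁺ x (act x) (≤-refl (act x))))

  goalFormula⁻ : ∀ l q e f r rs w → (∀ {r′} → r′ ∈ r ∷ rs → Sound r′) →
                 ⟦ goalFormula l q e f r rs ⟧ ⟦ w ⟧* → act f ≤ ⟦ l ∷ q ∷ w ++ e ∷ [] ⟧*
  goalFormula⁻ l q e f r rs w sound h P p
    with a , b , a∈f , b∈B , ab≤ ←
      h (act l ∙′ act q) (⨂⁺ l (q ∷ []) (act l ∙′ act q) (≤-refl (act l ∙′ act q))) (act e)
        -- Soundness of all the rules is what admits `𝟙` as a value of `bangProduct`.
        (act e , 𝟙 , letter⁺ e (act e) (≤-refl (act e)) , bangProduct⁺ r rs sound , ≤-refl (act e))
    = subst (λ t → apply (act l ∙′ act q ∙′ t) P _) (sym (⟦⟧*-++ w (e ∷ [])))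
        (ab≤ P (letter⁻ f a a∈f (apply b P) (mono (act f) (bangProduct⁻ r rs b b∈B P) p)))

  recognised⇒ : ∀ l q e f r rs w Π → (∀ {r′} → r′ ∈ r ∷ rs → Sound r′) →
                F.debracket Π ≡ map letter w → Π F.⊢ goalFormula l q e f r rs →
                act f ≤ ⟦ l ∷ q ∷ w ++ e ∷ [] ⟧*
  recognised⇒ l q e f r rs w Π sound eq d = goalFormula⁻ l q e f r rs w sound
    (Every-letters w (subst (λ As → Every (map F.fm As) _) eq (Every-debracket Π (soundness d))))

-- Turing machines as semi-Thue systems

module Machine {k : ℕ} (T : TuringMachine k) where
  open TuringMachine T

  Cell : Set
  Cell = Symbol k #work

  State : Set
  State = Fin #states

  -- A cell is a different letter on either side of the head, because act must
  -- push it onto a right tape but pop it from a left tape.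
  data Letter : Set where
    leftCell rightCell     : Cell → Letter
    head                   : State → Letter
    leftEnd rightEnd final : Letter

  cells : List Cell
  cells = blank ∷ map input (allFin k) ++ map work (allFin #work)

  ∈-cells : ∀ s → s ∈ cells
  ∈-cells blank     = here refl
  ∈-cells (input a) = there (∈-++⁺ˡ (∈-map⁺ input (∈-allFin a)))
  ∈-cells (work a)  = there (∈-++⁺ʳ (map input (allFin k)) (∈-map⁺ work (∈-allFin a)))

  letters : List Letter
  letters = leftEnd ∷ rightEnd ∷ final ∷
            map leftCell cells ++ map rightCell cells ++ map head (allFin #states)

  ∈-letters : ∀ x → x ∈ letters
  ∈-letters leftEnd       = here refl
  ∈-letters rightEnd      = there (here refl)
  ∈-letters final         = there (there (here refl))
  ∈-letters (leftCell s)  = there (there (there (∈-++⁺ˡ (∈-map⁺ leftCell (∈-cells s)))))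
  ∈-letters (rightCell s) =
    there (there (there (∈-++⁺ʳ (map leftCell cells) (∈-++⁺ˡ (∈-map⁺ rightCell (∈-cells s))))))
  ∈-letters (head q)      =
    there (there (there (∈-++⁺ʳ (map leftCell cells) (∈-++⁺ʳ (map rightCell cells)
      (∈-map⁺ head (∈-allFin q))))))

  code : Letter → ℕ
  code x = toℕ (index (∈-letters x))

  code-injective : ∀ {x y} → code x ≡ code y → x ≡ y
  code-injective {x} {y} eq =
    index-injective (≡.setoid Letter) (∈-letters x) (∈-letters y) (toℕ-injective eq)

  -- Rewriting rules of the machine

  data Instruction : Set where
    halt                 : Instruction
    extend               : State → Instruction
    eraseLeft eraseRight : Cell → Instruction
    -- the optional cell is the left neighbour of the head, used by moves to the left
    transition           : State → Cell → Maybe Cell → Instruction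

  extendRule : State → Rewrite Letter
  extendRule q = record
    { head = head q ; next = rightEnd ; rest = []
    ; out = head q ; outs = rightCell blank ∷ rightEnd ∷ [] }

  transitionRule : State → Cell → Maybe Cell → Maybe (State × Cell × Direction) → Rewrite Letter
  -- A filler where the machine halts: `extendRule q` is sound and belongs to the list anyway.
  transitionRule q s l nothing = extendRule q
  transitionRule q s l (just (q′ , s′ , right)) = record
    { head = head q ; next = rightCell s ; rest = []
    ; out = leftCell s′ ; outs = head q′ ∷ [] }
  transitionRule q s nothing (just (q′ , s′ , left)) = record
    { head = leftEnd ; next = head q ; rest = rightCell s ∷ []
    ; out = leftEnd ; outs = head q′ ∷ rightCell blank ∷ rightCell s′ ∷ [] }
  transitionRule q s (just l) (just (q′ , s′ , left)) = record
    { head = leftCell l ; next = head q ; rest = rightCell s ∷ []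
    ; out = head q′ ; outs = rightCell l ∷ rightCell s′ ∷ [] }

  toRule : Instruction → Rewrite Letter
  toRule halt               = record
    { head = leftEnd ; next = head accept ; rest = rightEnd ∷ [] ; out = final ; outs = [] }
  toRule (extend q)         = extendRule q
  toRule (eraseLeft s)      = record
    { head = leftCell s ; next = head accept ; rest = [] ; out = head accept ; outs = [] }
  toRule (eraseRight s)     = record
    { head = head accept ; next = rightCell s ; rest = [] ; out = head accept ; outs = [] }
  toRule (transition q s l) = transitionRule q s l (δ q s)

  maybeCells : List (Maybe Cell)
  maybeCells = nothing ∷ map just cells

  instructions : List Instruction
  instructions =
    map extend (allFin #states) ++ map eraseLeft cells ++ map eraseRight cells ++
    map (λ (q , s , l) → transition q s l)
        (cartesianProduct (allFin #states) (cartesianProduct cells maybeCells))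

  ∈-instructions : ∀ i → i ∈ halt ∷ instructions
  ∈-instructions halt = here refl
  ∈-instructions (extend q) = there (∈-++⁺ˡ (∈-map⁺ extend (∈-allFin q)))
  ∈-instructions (eraseLeft s) =
    there (∈-++⁺ʳ (map extend (allFin #states)) (∈-++⁺ˡ (∈-map⁺ eraseLeft (∈-cells s))))
  ∈-instructions (eraseRight s) =
    there (∈-++⁺ʳ (map extend (allFin #states)) (∈-++⁺ʳ (map eraseLeft cells)
      (∈-++⁺ˡ (∈-map⁺ eraseRight (∈-cells s)))))
  ∈-instructions (transition q s l) =
    there (∈-++⁺ʳ (map extend (allFin #states)) (∈-++⁺ʳ (map eraseLeft cells)
      (∈-++⁺ʳ (map eraseRight cells) (∈-map⁺ (λ (q , s , l) → transition q s l)
        (∈-cartesianProduct⁺ (∈-allFin q) (∈-cartesianProduct⁺ (∈-cells s) (∈-maybeCells l)))))))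
    where
    ∈-maybeCells : ∀ l → l ∈ maybeCells
    ∈-maybeCells nothing  = here refl
    ∈-maybeCells (just s) = there (∈-map⁺ just (∈-cells s))

  rules : List (Rewrite Letter)
  rules = map toRule (halt ∷ instructions)

  ∈-rules : ∀ i → toRule i ∈ rules
  ∈-rules i = ∈-map⁺ toRule (∈-instructions i)

  -- Soundness of the rules for accepting configurations

  Accepting : Configuration T → Set
  Accepting c = ∃[ c′ ] Star (_⟶_ T) c c′ × Configuration.state c′ ≡ accept

  -- In words the scanned cell is the first letter after the head, or is missing when `rightEnd`
  -- follows at once.
  scan : List Cell → State → List Cell → Configuration T
  scan ls q []       = config ls q blank []
  scan ls q (s ∷ rs) = config ls q s rs

  scan-accept : ∀ ls rs → Accepting (scan ls accept rs)
  scan-accept ls []       = _ , ε , refl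
  scan-accept ls (s ∷ rs) = _ , ε , refl

  move-right : ∀ ls q s rs → move T right ls q s rs ≡ scan (s ∷ ls) q rs
  move-right ls q s []       = refl
  move-right ls q s (r ∷ rs) = refl

  Accepting-step : ∀ {ls q s rs q′ s′ d} → δ q s ≡ just (q′ , s′ , d) →
                   Accepting (move T d ls q′ s′ rs) → Accepting (config ls q s rs)
  Accepting-step eq (c , run , acc) = c , step eq ◅ run , acc

  -- To the right of the head, the value of a suffix is the set of right tapes
  -- that it describes; from the head on, it is the set of left tapes with which
  -- it yields an accepting configuration.
  act : Letter → Transformer (List Cell)
  act (leftCell s)  = transformer (λ P ls → P (s ∷ ls)) (λ P⊆Q p → P⊆Q p)
  act (rightCell s) = transformer (λ P rs → ∃[ rs′ ] rs ≡ s ∷ rs′ × P rs′)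
                                  (λ { P⊆Q (rs′ , eq , p) → rs′ , eq , P⊆Q p })
  act (head q)      = transformer (λ P ls → ∃[ rs ] P rs × Accepting (scan ls q rs))
                                  (λ { P⊆Q (rs , p , acc) → rs , P⊆Q p , acc })
  act leftEnd       = transformer (λ P _ → P []) (λ P⊆Q p → P⊆Q p)
  act rightEnd      = transformer (λ _ rs → rs ≡ []) (λ _ eq → eq)
  act final         = transformer (λ _ _ → ⊤) (λ _ _ → tt)

  open Encoding code
  open Interpretation code code-injective act

  -- `scan` yields the same configuration for an empty right tape and for a single blank.
  extendRule-sound : ∀ q → Sound (extendRule q)
  extendRule-sound q P (_ , (_ , refl , refl) , acc) = [] , refl , acc

  -- The right side supplies an accepting successor, to which the machine step is prefixed. Keeping
  -- `m` apart from `δ q s` allows the case split while `eq` still justifies that step.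
  transitionRule-sound : ∀ q s l m → δ q s ≡ m → Sound (transitionRule q s l m)
  transitionRule-sound q s l nothing eq = extendRule-sound q
  transitionRule-sound q s l (just (q′ , s′ , right)) eq P {ls} (rs , p , acc) =
    s ∷ rs , (rs , refl , p) , Accepting-step eq (subst Accepting (sym (move-right ls q′ s′ rs)) acc)
  transitionRule-sound q s nothing (just (q′ , s′ , left)) eq P (_ , (_ , refl , (rs , refl , p)) , acc) =
    s ∷ rs , (rs , refl , p) , Accepting-step eq acc
  transitionRule-sound q s (just l) (just (q′ , s′ , left)) eq P (_ , (_ , refl , (rs , refl , p)) , acc) =
    s ∷ rs , (rs , refl , p) , Accepting-step eq acc

  -- Halting and erasing forget tape contents, harmlessly: a configuration in state `accept` is
  -- accepting whatever its tapes hold.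
  toRule-sound : ∀ i → Sound (toRule i)
  toRule-sound halt               _ _ = [] , refl , scan-accept [] []
  toRule-sound (extend q)         = extendRule-sound q
  toRule-sound (eraseLeft s)      P {ls} (rs , p , _) = rs , p , scan-accept (s ∷ ls) rs
  toRule-sound (eraseRight s)     P {ls} (rs , p , _) = s ∷ rs , (rs , refl , p) , scan-accept ls (s ∷ rs)
  toRule-sound (transition q s l) = transitionRule-sound q s l (δ q s) refl

  rules-sound : ∀ {r} → r ∈ rules → Sound r
  rules-sound r∈rules with i , _ , refl ← ∈-map⁻ toRule {xs = halt ∷ instructions} r∈rules = toRule-sound i

  inputWord : Word k → List Letter
  inputWord w = map rightCell (map input w)

  startWord : Word k → List Letter
  startWord w = leftEnd ∷ head start ∷ inputWord w ++ rightEnd ∷ []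

  -- Right cells closed by `rightEnd` denote the one tape they spell, so the right tape chosen in
  -- `act (head start)` can only be the input.
  startWord-accepted : ∀ w P → Transformer.apply ⟦ startWord w ⟧* P [] → Accepts T w
  startWord-accepted w P (rs , p , acc) = subst Accepting (initial≡ w)
    (subst (λ rs → Accepting (scan [] start rs)) (tape (map input w) rs p) acc)
    where
    tape : ∀ ss rs → Transformer.apply ⟦ map rightCell ss ++ rightEnd ∷ [] ⟧* P rs → rs ≡ ss
    tape []       rs eq = eq
    tape (s ∷ ss) _ (rs , refl , p) = cong (s ∷_) (tape ss rs p)

    initial≡ : ∀ w → scan [] start (map input w) ≡ initial T w
    initial≡ []      = refl
    initial≡ (a ∷ w) = refl

  -- `ʳ++` fits because a left half-tape lists the cell next to the head first; that cell is then
  -- exposed by computation alone.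
  encode : List Cell → State → List Cell → List Letter
  encode ls q rs = leftEnd ∷ (map leftCell ls ʳ++ (head q ∷ map rightCell rs ++ rightEnd ∷ []))

  encodeConfig : Configuration T → List Letter
  encodeConfig (config ls q s rs) = encode ls q (s ∷ rs)

  ʳ++-skip : ∀ x {u v} → rules ⊢ u ⇒ v → rules ⊢ x ʳ++ u ⇒ x ʳ++ v
  ʳ++-skip []      u⇒v = u⇒v
  ʳ++-skip (_ ∷ x) u⇒v = ʳ++-skip x (skip u⇒v)

  step-rule : ∀ {q s m} → δ q s ≡ m → ∀ l → transitionRule q s l m ∈ rules
  step-rule {q} {s} refl l = ∈-rules (transition q s l)

  encode-step : ∀ {c c′} → _⟶_ T c c′ → rules ⊢ encodeConfig c ⇒* encodeConfig c′
  encode-step (step {ls = []}     {d = left} eq) = here (step-rule eq nothing) _ ◅ ε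
  encode-step (step {ls = l ∷ ls} {d = left} eq) =
    skip (ʳ++-skip (map leftCell ls) (here (step-rule eq (just l)) _)) ◅ ε
  -- Past the last cell the head meets `rightEnd`, and a second rewriting step writes the blank that
  -- `move` scans.
  encode-step (step {ls = ls} {rs = []} {q′ = q′} {s′ = s′} {d = right} eq) =
    skip (ʳ++-skip (map leftCell ls) (here (step-rule eq nothing) _))
    ◅ skip (ʳ++-skip (map leftCell (s′ ∷ ls)) (here (∈-rules (extend q′)) []))
    ◅ ε
  encode-step (step {ls = ls} {rs = r ∷ rs} {d = right} eq) =
    skip (ʳ++-skip (map leftCell ls) (here (step-rule eq nothing) _)) ◅ ε

  encode-run : ∀ {c c′} → Star (_⟶_ T) c c′ → rules ⊢ encodeConfig c ⇒* encodeConfig c′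
  encode-run ε           = ε
  encode-run (s ◅ steps) = encode-step s ◅◅ encode-run steps

  erase : ∀ ls rs → rules ⊢ encode ls accept rs ⇒* final ∷ []
  erase []       []       = here (∈-rules halt) [] ◅ ε
  erase (l ∷ ls) []       = skip (ʳ++-skip (map leftCell ls) (here (∈-rules (eraseLeft l)) _)) ◅ erase ls []
  erase ls       (r ∷ rs) = skip (ʳ++-skip (map leftCell ls) (here (∈-rules (eraseRight r)) _)) ◅ erase ls rs

  Accepting⇒final : ∀ {c} → Accepting c → rules ⊢ encodeConfig c ⇒* final ∷ []
  Accepting⇒final (config ls _ s rs , run , refl) = encode-run run ◅◅ erase ls (s ∷ rs)

  grammar : Grammar k
  grammar = record
    { lexicon = map (λ a → a , letter (rightCell (input a))) (allFin k)
    ; goal    = goalFormula leftEnd (head start) rightEnd final (toRule halt) (map toRule instructions)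
    }

  open Grammar grammar using (_▷_; goal)

  ▷-inputWord : ∀ w → Pointwise _▷_ w (map letter (inputWord w))
  ▷-inputWord []      = []
  ▷-inputWord (a ∷ w) = ∈-map⁺ (λ a → a , letter (rightCell (input a))) (∈-allFin a) ∷ ▷-inputWord w

  ▷⇒inputWord : ∀ {w As} → Pointwise _▷_ w As → As ≡ map letter (inputWord w)
  ▷⇒inputWord []           = refl
  ▷⇒inputWord (a▷A ∷ rest)
    with _ , _ , refl ← ∈-map⁻ (λ a → a , letter (rightCell (input a))) a▷A =
      cong (_ ∷_) (▷⇒inputWord rest)

  Accepts⇒⊢ : ∀ {w} → w ≢ [] → Accepts T w → [] S.⨾ map S.fm (map letter (inputWord w)) S.⊢ goal
  Accepts⇒⊢ {[]}    ne _   with () ← ne refl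
  Accepts⇒⊢ {_ ∷ _} ne acc =
    -- For a nonempty word the start word is by computation the encoded initial configuration; for
    -- the empty word the latter has an extra blank.
    Simulation.recognise {r = toRule halt} {rs = map toRule instructions} (λ ()) (Accepting⇒final acc)

  ⊢⇒Accepts : ∀ {w Π} → Pointwise _▷_ w (F.debracket Π) → Π F.⊢ goal → Accepts T w
  ⊢⇒Accepts {w} {Π} p d = startWord-accepted w (λ _ → ⊤)
    (recognised⇒ leftEnd (head start) rightEnd final (toRule halt) (map toRule instructions)
      (inputWord w) Π (λ {r} → rules-sound {r}) (▷⇒inputWord p) d (λ _ → ⊤) {[]} tt)

-- Comparison of the four notions of recognition

open Embedding

map-fm-stoupless : ∀ As → S.Stoupless ([] S.⨾ map S.fm As)
map-fm-stoupless As = S.[]⨾ terms As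
  where
  terms : ∀ As → All S.StouplessTerm (map S.fm As)
  terms []       = []
  terms (A ∷ As) = S.fm A ∷ terms As

debracketAll-map-fm : ∀ As → S.debracketAll (map S.fm As) ≡ As
debracketAll-map-fm []       = refl
debracketAll-map-fm (A ∷ As) = cong (A ∷_) (debracketAll-map-fm As)

debracket-map-fm : ∀ As → F.debracket (map F.fm As) ≡ As
debracket-map-fm []       = refl
debracket-map-fm (A ∷ As) = cong (A ∷_) (debracket-map-fm As)

⌊⌋*-map-fm : ∀ As → ⌊ map S.fm As ⌋* ≡ map F.fm As
⌊⌋*-map-fm []       = refl
⌊⌋*-map-fm (A ∷ As) = cong (F.fm A ∷_) (⌊⌋*-map-fm As)

module _ {k : ℕ} (G : Grammar k) where
  stoup-s⊆t : S.SRecognised G ⊆ S.TRecognised G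
  stoup-s⊆t (As , p , d) =
    _ , map-fm-stoupless As , subst (Pointwise _ _) (sym (debracketAll-map-fm As)) p , d

  stoup-s⊆stoupfree-s : S.SRecognised G ⊆ F.SRecognised G
  stoup-s⊆stoupfree-s (As , p , d) = As , p , subst (F._⊢ _) (⌊⌋*-map-fm As) (embed d)

  stoup-t⊆stoupfree-t : S.TRecognised G ⊆ F.TRecognised G
  stoup-t⊆stoupfree-t (Π , stoupless , p , d) =
    ⌊ Π ⌋ , subst (Pointwise _ _) (sym (debracket-⌊⌋ stoupless)) p , embed d

  stoupfree-s⊆t : F.SRecognised G ⊆ F.TRecognised G
  stoupfree-s⊆t (As , p , d) = _ , subst (Pointwise _ _) (sym (debracket-map-fm As)) p , d

theorem12 : ∀ {ℓ} {k : ℕ} (M : Pred (Word k) ℓ) →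
    RecursivelyEnumerable M → [] ∉ M →
    (∃[ G ] (M ≐ StoupCalculus.SRecognised {k} G) × (M ≐ StoupCalculus.TRecognised {k} G))
    × (∃[ G ] (M ≐ StoupFreeCalculus.SRecognised {k} G) × (M ≐ StoupFreeCalculus.TRecognised {k} G))
theorem12 {k = k} M (T , M⊆Accepts , Accepts⊆M) []∉M =
  -- s-recognition with stoups accepts the fewest words and t-recognition without stoups the most,
  -- so `M⊆s` and `t⊆M` squeeze all four languages onto `M`.
  (G , (M⊆s , t⊆M ∘ stoup-t⊆stoupfree-t G ∘ stoup-s⊆t G)
     , (stoup-s⊆t G ∘ M⊆s , t⊆M ∘ stoup-t⊆stoupfree-t G)) ,
  (G , (stoup-s⊆stoupfree-s G ∘ M⊆s , t⊆M ∘ stoupfree-s⊆t G)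
     , (stoupfree-s⊆t G ∘ stoup-s⊆stoupfree-s G ∘ M⊆s , t⊆M))
  where
  open Machine T

  G : Grammar k
  G = grammar

  M⊆s : M ⊆ S.SRecognised G
  M⊆s {w} w∈M = _ , ▷-inputWord w , Accepts⇒⊢ (λ { refl → []∉M w∈M }) (M⊆Accepts w∈M)

  t⊆M : F.TRecognised G ⊆ M
  t⊆M (Π , p , d) = Accepts⊆M (⊢⇒Accepts {Π = Π} p d)
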